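{- Let $n=4k+r$ with integers $k\ge 0$ and $0\le r<4$. Then $$t_n=2^{k+\lfloor r/2\rfloor}\sum_{i=0}^{k}2^{i}\binom{k}{i}\frac{(1;2)_{k+\lfloor r/2\rfloor}}{(1;2)_{i+\lfloor r/2\rfloor}}\,g_{4i+r}.$$
   Context: $t_n$ is the number of involutions (permutations $\pi$ with $\pi^2=1$) of $[n]$, with $t_0=1$. $(a;b)_m=\prod_{j=0}^{m-1}(a+jb)$, so $(1;2)_m$ is the product of the first $m$ odd positive integers. For $m=2u+\rho$ with $\rho\in\{0,1\}$, let $V_m=\{v_1,\dots,v_u\}$ if $\rho=0$ and $V_m=\{v_1,\dots,v_{u+1}\}$ if $\rho=1$; $\mathfrak{G}_m$ is the set of loopless multigraphs on $V_m$ in which each vertex has degree at most $2$, $v_{u+1}$ (if present) has degree at most $1$, and each edge has multiplicity at most $2$. $g_m$ is the number of graphs in $\mathfrak{G}_m$ having no edge of multiplicity $2$. -}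

module Defs where

open import Data.Nat using (ℕ; zero; suc; _+_; _*_; _≤_; _≤?_; NonZero; _/_; _%_; _≟_)
open import Data.Nat.Properties using (_≤?_)
open import Data.Fin using (Fin; toℕ) renaming (_≟_ to _≟ᶠ_)
open import Data.Fin.Properties using (all?)
open import Data.Vec using (Vec; []; _∷_; lookup)
open import Data.List using (List; []; _∷_; length; filter; map; concatMap; upTo; allFin)
open import Data.Nat.ListAction using (sum)
open import Data.Product using (_×_)
open import Data.Bool using (Bool; true; false; if_then_else_; _∧_)
open import Relation.Binary.PropositionalEquality using (_≡_; refl)
open import Relation.Nullary using (Dec; does)
open import Relation.Nullary.Decidable using (_×-dec_; _→-dec_)

allVecs : {A : Set} → List A → (n : ℕ) → List (Vec A n)
allVecs xs zero    = [] ∷ []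
allVecs xs (suc n) = concatMap (λ x → map (x ∷_) (allVecs xs n)) xs

-- Involutions of [n] = Fin n.
-- A map Fin n → Fin n is given by its table (Vec (Fin n) n).
-- A permutation is an injective (hence bijective, as Fin n is finite) map;
-- an involution is a permutation π with π ∘ π = id.

IsPerm : {n : ℕ} → Vec (Fin n) n → Set
IsPerm {n} π = ∀ (x y : Fin n) → lookup π x ≡ lookup π y → x ≡ y

IsInvolution : {n : ℕ} → Vec (Fin n) n → Set
IsInvolution {n} π = IsPerm π × (∀ (x : Fin n) → lookup π (lookup π x) ≡ x)

isInvolution? : {n : ℕ} (π : Vec (Fin n) n) → Dec (IsInvolution π)
isInvolution? π =
  all? (λ x → all? (λ y → (lookup π x ≟ᶠ lookup π y) →-dec (x ≟ᶠ y)))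
  ×-dec all? (λ x → lookup π (lookup π x) ≟ᶠ x)

t : ℕ → ℕ
t n = length (filter isInvolution? (allVecs (allFin n) n))

poch : ℕ → ℕ → ℕ → ℕ
poch a b zero    = 1
poch a b (suc m) = poch a b m * (a + m * b)

poch12-nonZero : ∀ m → NonZero (poch 1 2 m)
poch12-nonZero zero    = _
poch12-nonZero (suc m) = helper (poch 1 2 m) (m * 2) (poch12-nonZero m)
  where
  helper : ∀ p q → NonZero p → NonZero (p * suc q)
  helper (suc p) q _ = _

-- (1;2)_K / (1;2)_I  (exact division in ℕ when I ≤ K)
poch12Quot : ℕ → ℕ → ℕ
poch12Quot K I = _/_ (poch 1 2 K) (poch 1 2 I) {{poch12-nonZero I}}

-- The family 𝔊_m and g_m.
-- m = 2u + ρ, u = m / 2, ρ = m % 2.  V_m = Fin (u + ρ); when ρ = 1 the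
-- special vertex v_{u+1} is the vertex with index u.
-- A loopless multigraph on V with edge multiplicities ≤ 2 is a
-- symmetric multiplicity matrix M : V × V → {0,1,2} with zero diagonal.

numV : ℕ → ℕ
numV m = m / 2 + m % 2

Mult : ℕ → Set
Mult v = Vec (Vec (Fin 3) v) v

mult : {v : ℕ} → Mult v → Fin v → Fin v → ℕ
mult M x y = toℕ (lookup (lookup M x) y)

deg : {v : ℕ} → Mult v → Fin v → ℕ
deg {v} M x = sum (map (mult M x) (allFin v))

-- degree cap: 1 for the special vertex v_{u+1} (present iff ρ = 1), else 2
cap : (m : ℕ) → Fin (numV m) → ℕ
cap m x = if does (m % 2 ≟ 1) ∧ does (toℕ x ≟ m / 2) then 1 else 2

InG : (m : ℕ) → Mult (numV m) → Set
InG m M = (∀ x y → mult M x y ≡ mult M y x)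
        × (∀ x → mult M x x ≡ 0)
        × (∀ x → deg M x ≤ cap m x)
-- (edge multiplicities ≤ 2 are built into Fin 3)

NoDouble : {v : ℕ} → Mult v → Set
NoDouble M = ∀ x y → mult M x y ≤ 1

counted? : (m : ℕ) (M : Mult (numV m)) → Dec (InG m M × NoDouble M)
counted? m M =
  ((all? λ x → all? λ y → mult M x y ≟ mult M y x)
   ×-dec ((all? λ x → mult M x x ≟ 0)
   ×-dec (all? λ x → deg M x ≤? cap m x)))
  ×-dec (all? λ x → all? λ y → mult M x y ≤? 1)

allMult : (v : ℕ) → List (Mult v)
allMult v = allVecs (allVecs (allFin 3) v) v

g : ℕ → ℕ
g m = length (filter (counted? m) (allMult (numV m)))

Σ[0to_] : ℕ → (ℕ → ℕ) → ℕ
Σ[0to k ] f = sum (map f (upTo (suc k)))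

{-# OPTIONS --safe #-}
-- Split 2b of n = a + 2b points into b pairs and contract each pair: the 2-cycles
-- of an involution of the n points become the edges of a loopless multigraph with
-- a vertices of capacity 1 and b of capacity 2 (loops and fixed points are
-- forgotten).  A multigraph with d double edges has 2^(b-d) preimages, so
--   t (a + 2b) = Σ_d (number of d-edge matchings on b points) 2^(b-d) G(a, b-2d),
-- where G(a, b) counts the simple graphs, so t n = G(n, 0) and g (2u + ρ) = G(ρ, u).
-- Instead of the contraction, both sides are shown to satisfy the same recurrences,
-- obtained for G by deleting a vertex and lowering the capacities of its neighbours.
-- For b = 2k + h the coefficients are those of the theorem, by Pascal's rule.
module Submission where

open import Defs
open import Data.Nat using (ℕ; _+_; _*_; _^_; _<_; _/_)
open import Data.Nat.Combinatorics using (_C_)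
open import Relation.Binary.PropositionalEquality using (_≡_)

open import Data.Bool using (true; false; if_then_else_; _∧_)
open import Data.Fin using (Fin; zero; suc; toℕ; inject₁) renaming (_≟_ to _≟ᶠ_)
open import Data.Fin.Properties using (all?; any?; toℕ-injective; toℕ-inject₁)
open import Data.List using (List; []; _∷_; _++_; _∷ʳ_; map; length; filter; concatMap; cartesianProduct; allFin; upTo)
open import Data.List.Properties using (map-++; map-cong; map-∘; map-tabulate; map-applyUpTo; map-upTo; upTo-∷ʳ)
open import Data.Nat using (zero; suc; _%_; _≤_; _≤?_; _≟_; z≤n; s≤s)
open import Data.Nat.Combinatorics using (nCk+nC[k+1]≡[n+1]C[k+1]; k>n⇒nCk≡0)
open import Data.Nat.DivMod using (m≡m%n+[m/n]*n; m%n<n; m<n*o⇒m/o<n; m/n*n≡m; m*n/n≡m; +-distrib-/-∣ˡ; [m+kn]%n≡m%n; /-congˡ; %-congˡ)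
open import Data.Nat.Divisibility using (_∣_; ∣-refl; ∣m⇒∣m*n; n∣m*n)
open import Data.Nat.Induction using (<-rec)
open import Data.Nat.ListAction using (sum)
open import Data.Nat.ListAction.Properties using (sum-++)
open import Data.Nat.Properties
open import Algebra.Properties.CommutativeSemigroup +-commutativeSemigroup using (interchange; xy∙z≈xz∙y)
open import Data.Nat.Tactic.RingSolver using (solve-∀)
open import Data.Product using (_×_; _,_; proj₁; proj₂; ∃)
open import Data.Product.Properties using () renaming (≡-dec to ×-≡-dec)
open import Data.Sum using (inj₁; inj₂)
open import Data.Vec using (Vec; []; _∷_; lookup; head; tail; zipWith; replicate; tabulate)
import Data.Vec as Vec
import Data.Vec.Properties as Vec
open import Function using (_∘_; id)
open import Relation.Binary.Definitions using (DecidableEquality)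
open import Relation.Binary.PropositionalEquality using (_≢_; _≗_; refl; sym; trans; cong; cong₂; subst; module ≡-Reasoning)
open import Relation.Nullary using (Dec; yes; no; does; ¬_; contradiction)
open import Relation.Nullary.Decidable using (_×-dec_; ¬?)

-- The factor 2^(b-d) arises locally. A pair off the double edges contributes 2: its points are
-- fixed or swapped (degree 0), either of them is the matched one (degree 1), or they take the two
-- edges in either order (degree 2). A double edge contributes 2 for its two pairs together.
-- Deleting a vertex lowers capacities at arbitrary places. The counts are therefore defined for
-- every list of capacities, zeros included, and the main obstacle is to show that they depend only
-- on how many ones and twos occur. Matrices are never permuted for this: the sum over
-- neighbourhoods is expressed through the two numbers by the operator `D`, and a single exchange of
-- two leading vertices supplies the rest. Two recurrences are enough: deletion of a vertex of
-- capacity 1 for all a and b, and deletion of a vertex of capacity 2 for a = 0. The second is kept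
-- multiplied by 2, since two half-edges are counted in order.

private variable
  A B : Set
  n v w : ℕ

-- Finite sums and enumerations

∑ : List A → (A → ℕ) → ℕ
∑ xs φ = sum (map φ xs)

∑-cong : ∀ (xs : List A) {φ ψ : A → ℕ} → φ ≗ ψ → ∑ xs φ ≡ ∑ xs ψ
∑-cong xs φ≗ψ = cong sum (map-cong φ≗ψ xs)

∑-0 : ∀ (xs : List A) → ∑ xs (λ _ → 0) ≡ 0
∑-0 []       = refl
∑-0 (x ∷ xs) = ∑-0 xs

∑-+ : ∀ (xs : List A) (φ ψ : A → ℕ) → ∑ xs (λ x → φ x + ψ x) ≡ ∑ xs φ + ∑ xs ψ
∑-+ []       φ ψ = refl
∑-+ (x ∷ xs) φ ψ rewrite ∑-+ xs φ ψ = interchange (φ x) (ψ x) (∑ xs φ) (∑ xs ψ)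

∑-*ˡ : ∀ (xs : List A) c (φ : A → ℕ) → ∑ xs (λ x → c * φ x) ≡ c * ∑ xs φ
∑-*ˡ []       c φ = sym (*-zeroʳ c)
∑-*ˡ (x ∷ xs) c φ rewrite ∑-*ˡ xs c φ = sym (*-distribˡ-+ c (φ x) (∑ xs φ))

∑-*ʳ : ∀ (xs : List A) c (φ : A → ℕ) → ∑ xs (λ x → φ x * c) ≡ ∑ xs φ * c
∑-*ʳ xs c φ = begin
  ∑ xs (λ x → φ x * c)  ≡⟨ ∑-cong xs (λ x → *-comm (φ x) c) ⟩
  ∑ xs (λ x → c * φ x)  ≡⟨ ∑-*ˡ xs c φ ⟩
  c * ∑ xs φ            ≡⟨ *-comm c _ ⟩
  ∑ xs φ * c            ∎
  where open ≡-Reasoning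

∑-swap : ∀ (xs : List A) (ys : List B) (φ : A → B → ℕ) →
         ∑ xs (λ x → ∑ ys (φ x)) ≡ ∑ ys (λ y → ∑ xs (λ x → φ x y))
∑-swap []       ys φ = sym (∑-0 ys)
∑-swap (x ∷ xs) ys φ rewrite ∑-swap xs ys φ = sym (∑-+ ys (φ x) _)

∑-++ : ∀ (xs ys : List A) (φ : A → ℕ) → ∑ (xs ++ ys) φ ≡ ∑ xs φ + ∑ ys φ
∑-++ xs ys φ rewrite map-++ φ xs ys = sum-++ (map φ xs) (map φ ys)

∑-map : ∀ (f : A → B) xs (φ : B → ℕ) → ∑ (map f xs) φ ≡ ∑ xs (φ ∘ f)
∑-map f xs φ = cong sum (sym (map-∘ xs))

∑-concatMap : ∀ (f : A → List B) xs (φ : B → ℕ) →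
              ∑ (concatMap f xs) φ ≡ ∑ xs (λ x → ∑ (f x) φ)
∑-concatMap f []       φ = refl
∑-concatMap f (x ∷ xs) φ =
  trans (∑-++ (f x) (concatMap f xs) φ) (cong (∑ (f x) φ +_) (∑-concatMap f xs φ))

∑-cartesianProduct : ∀ (xs : List A) (ys : List B) (φ : A × B → ℕ) →
                     ∑ (cartesianProduct xs ys) φ ≡ ∑ xs (λ x → ∑ ys (λ y → φ (x , y)))
∑-cartesianProduct []       ys φ = refl
∑-cartesianProduct (x ∷ xs) ys φ =
  trans (∑-++ (map (x ,_) ys) _ φ) (cong₂ _+_ (∑-map (x ,_) ys φ) (∑-cartesianProduct xs ys φ))

∑-allVecs : ∀ (xs : List A) n (φ : Vec A (suc n) → ℕ) →
            ∑ (allVecs xs (suc n)) φ ≡ ∑ xs (λ x → ∑ (allVecs xs n) (λ v → φ (x ∷ v)))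
∑-allVecs xs n φ =
  trans (∑-concatMap _ xs φ) (∑-cong xs (λ x → ∑-map (x ∷_) (allVecs xs n) φ))

∑-allFin : ∀ n (φ : Fin (suc n) → ℕ) →
           ∑ (allFin (suc n)) φ ≡ φ zero + ∑ (allFin n) (φ ∘ suc)
∑-allFin n φ = cong (λ l → φ zero + sum l)
  (trans (map-tabulate suc φ) (sym (map-tabulate id (φ ∘ suc))))

[_] : {P : Set} → Dec P → ℕ
[ yes _ ] = 1
[ no _ ]  = 0

[]-yes : {P : Set} (P? : Dec P) → P → [ P? ] ≡ 1
[]-yes (yes _) _ = refl
[]-yes (no ¬p) p = contradiction p ¬p

[]-no : {P : Set} (P? : Dec P) → ¬ P → [ P? ] ≡ 0
[]-no (yes p) ¬p = contradiction p ¬p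
[]-no (no _)  _  = refl

[]-⇔ : {P Q : Set} (P? : Dec P) (Q? : Dec Q) → (P → Q) → (Q → P) → [ P? ] ≡ [ Q? ]
[]-⇔ (yes p) Q? to from = sym ([]-yes Q? (to p))
[]-⇔ (no ¬p) Q? to from = sym ([]-no Q? (¬p ∘ from))

[]-× : {P Q : Set} (P? : Dec P) (Q? : Dec Q) → [ P? ×-dec Q? ] ≡ [ P? ] * [ Q? ]
[]-× (yes _) (yes _) = refl
[]-× (yes _) (no _)  = refl
[]-× (no _)  Q?      = refl

length-filter : {P : A → Set} (P? : ∀ x → Dec (P x)) (xs : List A) →
                length (filter P? xs) ≡ ∑ xs (λ x → [ P? x ])
length-filter P? []       = refl
length-filter P? (x ∷ xs) with P? x
... | yes _ = cong suc (length-filter P? xs)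
... | no _  = length-filter P? xs

-- Decidable equality turns `[ x ≟ᵉ a ]` into a Kronecker delta, so sums over different enumerations
-- can be compared without exhibiting a permutation of lists.
record Enumeration (A : Set) : Set where
  field
    elements : List A
    _≟ᵉ_     : DecidableEquality A
    once     : ∀ a → ∑ elements (λ x → [ x ≟ᵉ a ]) ≡ 1

  ∑-select : ∀ (φ : A → ℕ) a → ∑ elements (λ x → [ x ≟ᵉ a ] * φ x) ≡ φ a
  ∑-select φ a = begin
    ∑ elements (λ x → [ x ≟ᵉ a ] * φ x)  ≡⟨ ∑-cong elements at-a ⟩
    ∑ elements (λ x → [ x ≟ᵉ a ] * φ a)  ≡⟨ ∑-*ʳ elements (φ a) _ ⟩
    ∑ elements (λ x → [ x ≟ᵉ a ]) * φ a  ≡⟨ cong (_* φ a) (once a) ⟩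
    1 * φ a                              ≡⟨ *-identityˡ (φ a) ⟩
    φ a                                  ∎
    where
    open ≡-Reasoning
    at-a : ∀ x → [ x ≟ᵉ a ] * φ x ≡ [ x ≟ᵉ a ] * φ a
    at-a x with x ≟ᵉ a
    ... | yes refl = refl
    ... | no _     = refl

-- Both sides equal the sum of φ x over the pairs (x , y) with x ≡ h y.
module _ (E : Enumeration A) (F : Enumeration B) where
  private
    module E = Enumeration E
    module F = Enumeration F

  ∑-reindex : (h : B → A) (f : A → B) → (∀ b → f (h b) ≡ b) →
              (φ : A → ℕ) → (∀ a → φ a ≢ 0 → h (f a) ≡ a) →
              ∑ E.elements φ ≡ ∑ F.elements (φ ∘ h)
  ∑-reindex h f f∘h φ supp = begin
    ∑ E.elements φ
      ≡⟨ ∑-cong E.elements spread ⟩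
    ∑ E.elements (λ a → ∑ F.elements (λ b → [ a E.≟ᵉ h b ] * φ a))
      ≡⟨ ∑-swap E.elements F.elements _ ⟩
    ∑ F.elements (λ b → ∑ E.elements (λ a → [ a E.≟ᵉ h b ] * φ a))
      ≡⟨ ∑-cong F.elements (λ b → E.∑-select φ (h b)) ⟩
    ∑ F.elements (φ ∘ h) ∎
    where
    open ≡-Reasoning
    spread : ∀ a → φ a ≡ ∑ F.elements (λ b → [ a E.≟ᵉ h b ] * φ a)
    -- Off the support `h (f a)` may differ from `a`, but there every summand is 0. On the support
    -- `a ≡ h b` is equivalent to `b ≡ f a`, which selects one `b`.
    spread a with φ a ≟ 0
    ... | yes φa≡0 rewrite φa≡0 =
      sym (trans (∑-cong F.elements (λ b → *-zeroʳ [ a E.≟ᵉ h b ])) (∑-0 F.elements))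
    ... | no φa≢0 = sym (begin
      ∑ F.elements (λ b → [ a E.≟ᵉ h b ] * φ a)
        ≡⟨ ∑-cong F.elements (λ b → cong (_* φ a)
             ([]-⇔ (a E.≟ᵉ h b) (b F.≟ᵉ f a)
               (λ { refl → sym (f∘h b) })
               (λ { refl → sym (supp a φa≢0) }))) ⟩
      ∑ F.elements (λ b → [ b F.≟ᵉ f a ] * φ a)
        ≡⟨ F.∑-select (λ _ → φ a) (f a) ⟩
      φ a ∎)

finEnumeration : ∀ n → Enumeration (Fin n)
finEnumeration n = record { elements = allFin n ; _≟ᵉ_ = _≟ᶠ_ ; once = fin-once n }
  where
  fin-once : ∀ n (a : Fin n) → ∑ (allFin n) (λ x → [ x ≟ᶠ a ]) ≡ 1
  fin-once (suc n) zero =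
    trans (∑-allFin n (λ x → [ x ≟ᶠ zero ])) (cong suc (∑-0 (allFin n)))
  fin-once (suc n) (suc a) = begin
    ∑ (allFin (suc n)) (λ x → [ x ≟ᶠ suc a ])
      ≡⟨ ∑-allFin n (λ x → [ x ≟ᶠ suc a ]) ⟩
    ∑ (allFin n) (λ x → [ suc x ≟ᶠ suc a ])
      ≡⟨ ∑-cong (allFin n) (λ x → []-⇔ (suc x ≟ᶠ suc a) (x ≟ᶠ a) (λ { refl → refl }) (cong suc)) ⟩
    ∑ (allFin n) (λ x → [ x ≟ᶠ a ])
      ≡⟨ fin-once n a ⟩
    1 ∎
    where open ≡-Reasoning

vecEnumeration : Enumeration A → ∀ n → Enumeration (Vec A n)
vecEnumeration {A} E n = record
  { elements = allVecs elements n ; _≟ᵉ_ = Vec.≡-dec _≟ᵉ_ ; once = vec-once n }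
  where
  open Enumeration E
  open ≡-Reasoning
  vec-once : ∀ n (a : Vec A n) → ∑ (allVecs elements n) (λ x → [ Vec.≡-dec _≟ᵉ_ x a ]) ≡ 1
  vec-once zero    []       = refl
  vec-once (suc n) (a ∷ as) = begin
    ∑ (allVecs elements (suc n)) (λ x → [ Vec.≡-dec _≟ᵉ_ x (a ∷ as) ])
      ≡⟨ ∑-allVecs elements n _ ⟩
    ∑ elements (λ x → ∑ (allVecs elements n) (λ xs → [ Vec.≡-dec _≟ᵉ_ (x ∷ xs) (a ∷ as) ]))
      ≡⟨ ∑-cong elements (λ x → ∑-cong (allVecs elements n) (split x)) ⟩
    ∑ elements (λ x → ∑ (allVecs elements n) (λ xs → [ x ≟ᵉ a ] * [ Vec.≡-dec _≟ᵉ_ xs as ]))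
      ≡⟨ ∑-cong elements (λ x → ∑-*ˡ (allVecs elements n) [ x ≟ᵉ a ] _) ⟩
    ∑ elements (λ x → [ x ≟ᵉ a ] * ∑ (allVecs elements n) (λ xs → [ Vec.≡-dec _≟ᵉ_ xs as ]))
      ≡⟨ ∑-select _ a ⟩
    ∑ (allVecs elements n) (λ xs → [ Vec.≡-dec _≟ᵉ_ xs as ])
      ≡⟨ vec-once n as ⟩
    1 ∎
    where
    split : ∀ x xs → [ Vec.≡-dec _≟ᵉ_ (x ∷ xs) (a ∷ as) ] ≡ [ x ≟ᵉ a ] * [ Vec.≡-dec _≟ᵉ_ xs as ]
    split x xs = trans
      ([]-⇔ (Vec.≡-dec _≟ᵉ_ (x ∷ xs) (a ∷ as)) ((x ≟ᵉ a) ×-dec Vec.≡-dec _≟ᵉ_ xs as)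
        (λ { refl → refl , refl }) (λ { (refl , refl) → refl }))
      ([]-× (x ≟ᵉ a) (Vec.≡-dec _≟ᵉ_ xs as))

×-enumeration : Enumeration A → Enumeration B → Enumeration (A × B)
×-enumeration E F = record
  { elements = cartesianProduct E.elements F.elements
  ; _≟ᵉ_     = ×-≡-dec E._≟ᵉ_ F._≟ᵉ_
  ; once     = λ { (a , b) → begin
      ∑ (cartesianProduct E.elements F.elements) (λ p → [ ×-≡-dec E._≟ᵉ_ F._≟ᵉ_ p (a , b) ])
        ≡⟨ ∑-cartesianProduct E.elements F.elements _ ⟩
      ∑ E.elements (λ x → ∑ F.elements (λ y → [ ×-≡-dec E._≟ᵉ_ F._≟ᵉ_ (x , y) (a , b) ]))
        ≡⟨ ∑-cong E.elements (λ x → ∑-cong F.elements (split a b x)) ⟩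
      ∑ E.elements (λ x → ∑ F.elements (λ y → [ x E.≟ᵉ a ] * [ y F.≟ᵉ b ]))
        ≡⟨ ∑-cong E.elements (λ x → ∑-*ˡ F.elements [ x E.≟ᵉ a ] _) ⟩
      ∑ E.elements (λ x → [ x E.≟ᵉ a ] * ∑ F.elements (λ y → [ y F.≟ᵉ b ]))
        ≡⟨ E.∑-select _ a ⟩
      ∑ F.elements (λ y → [ y F.≟ᵉ b ])
        ≡⟨ F.once b ⟩
      1 ∎ }
  }
  where
  module E = Enumeration E
  module F = Enumeration F
  open ≡-Reasoning
  split : ∀ a b x y → [ ×-≡-dec E._≟ᵉ_ F._≟ᵉ_ (x , y) (a , b) ] ≡ [ x E.≟ᵉ a ] * [ y F.≟ᵉ b ]
  split a b x y = trans
    ([]-⇔ (×-≡-dec E._≟ᵉ_ F._≟ᵉ_ (x , y) (a , b)) ((x E.≟ᵉ a) ×-dec (y F.≟ᵉ b))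
      (λ { refl → refl , refl }) (λ { (refl , refl) → refl }))
    ([]-× (x E.≟ᵉ a) (y F.≟ᵉ b))

-- Graphs with bounded degrees

Caps : ℕ → Set
Caps = Vec (Fin 3)

-- Sum of k over the capacities left when a new vertex of capacity c is joined
-- to at most c distinct vertices.
∑-nbhd : ℕ → Caps v → (Caps v → ℕ) → ℕ
∑-nbhd c       []           k = k []
∑-nbhd c       (zero ∷ cs)  k = ∑-nbhd c cs (k ∘ (zero ∷_))
∑-nbhd zero    (suc z ∷ cs) k = ∑-nbhd zero cs (k ∘ (suc z ∷_))
∑-nbhd (suc c) (suc z ∷ cs) k = ∑-nbhd (suc c) cs (k ∘ (suc z ∷_)) + ∑-nbhd c cs (k ∘ (inject₁ z ∷_))

∑-nbhd-cong : ∀ c (cs : Caps v) {k l : Caps v → ℕ} → k ≗ l → ∑-nbhd c cs k ≡ ∑-nbhd c cs l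
∑-nbhd-cong c       []           k≗l = k≗l []
∑-nbhd-cong c       (zero ∷ cs)  k≗l = ∑-nbhd-cong c cs (k≗l ∘ (zero ∷_))
∑-nbhd-cong zero    (suc z ∷ cs) k≗l = ∑-nbhd-cong zero cs (k≗l ∘ (suc z ∷_))
∑-nbhd-cong (suc c) (suc z ∷ cs) k≗l =
  cong₂ _+_ (∑-nbhd-cong (suc c) cs (k≗l ∘ (suc z ∷_))) (∑-nbhd-cong c cs (k≗l ∘ (inject₁ z ∷_)))

∑-nbhd-*ˡ : ∀ c (cs : Caps v) m (k : Caps v → ℕ) → ∑-nbhd c cs (λ ds → m * k ds) ≡ m * ∑-nbhd c cs k
∑-nbhd-*ˡ c       []           m k = refl
∑-nbhd-*ˡ c       (zero ∷ cs)  m k = ∑-nbhd-*ˡ c cs m _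
∑-nbhd-*ˡ zero    (suc z ∷ cs) m k = ∑-nbhd-*ˡ zero cs m _
∑-nbhd-*ˡ (suc c) (suc z ∷ cs) m k =
  trans (cong₂ _+_ (∑-nbhd-*ˡ (suc c) cs m _) (∑-nbhd-*ˡ c cs m _)) (sym (*-distribˡ-+ m _ _))

∑-nbhd-∑ : ∀ c (cs : Caps v) (xs : List A) (k : Caps v → A → ℕ) →
           ∑-nbhd c cs (λ ds → ∑ xs (k ds)) ≡ ∑ xs (λ x → ∑-nbhd c cs (λ ds → k ds x))
∑-nbhd-∑ c       []           xs k = refl
∑-nbhd-∑ c       (zero ∷ cs)  xs k = ∑-nbhd-∑ c cs xs _
∑-nbhd-∑ zero    (suc z ∷ cs) xs k = ∑-nbhd-∑ zero cs xs _
∑-nbhd-∑ (suc c) (suc z ∷ cs) xs k =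
  trans (cong₂ _+_ (∑-nbhd-∑ (suc c) cs xs _) (∑-nbhd-∑ c cs xs _)) (sym (∑-+ xs _ _))

∑-nbhd-+ : ∀ c (cs : Caps v) (k l : Caps v → ℕ) →
           ∑-nbhd c cs (λ ds → k ds + l ds) ≡ ∑-nbhd c cs k + ∑-nbhd c cs l
∑-nbhd-+ c       []           k l = refl
∑-nbhd-+ c       (zero ∷ cs)  k l = ∑-nbhd-+ c cs _ _
∑-nbhd-+ zero    (suc z ∷ cs) k l = ∑-nbhd-+ zero cs _ _
∑-nbhd-+ (suc c) (suc z ∷ cs) k l =
  trans (cong₂ _+_ (∑-nbhd-+ (suc c) cs (k ∘ (suc z ∷_)) (l ∘ (suc z ∷_)))
                   (∑-nbhd-+ c cs (k ∘ (inject₁ z ∷_)) (l ∘ (inject₁ z ∷_))))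
        (interchange (∑-nbhd (suc c) cs (k ∘ (suc z ∷_))) _ _ _)

Fits : (Fin v → ℕ) → Caps v → Set
Fits d cs = ∀ x → d x ≤ toℕ (lookup cs x)

fits? : (d : Fin v → ℕ) (cs : Caps v) → Dec (Fits d cs)
fits? d cs = all? λ x → d x ≤? toℕ (lookup cs x)

fits-∷ : ∀ (d : Fin (suc v) → ℕ) z zs →
         [ fits? d (z ∷ zs) ] ≡ [ d zero ≤? toℕ z ] * [ fits? (d ∘ suc) zs ]
fits-∷ d z zs = trans
  ([]-⇔ (fits? d (z ∷ zs)) ((d zero ≤? toℕ z) ×-dec fits? (d ∘ suc) zs)
    (λ p → p zero , p ∘ suc) (λ { (p , q) zero → p ; (p , q) (suc x) → q x }))
  ([]-× (d zero ≤? toℕ z) (fits? (d ∘ suc) zs))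

∑ʳ : Vec (Fin 3) v → ℕ
∑ʳ {v} r = ∑ (allFin v) (toℕ ∘ lookup r)

∑ʳ-∷ : ∀ e (r : Vec (Fin 3) v) → ∑ʳ (e ∷ r) ≡ toℕ e + ∑ʳ r
∑ʳ-∷ {v} e r = ∑-allFin v (toℕ ∘ lookup (e ∷ r))

-- The conditions that a new vertex with row `r` adds to those on the old graph, `d` being the old
-- degrees. An arbitrary `d` is allowed because the induction over the row passes to `d ∘ suc`,
-- which is not the degree function of a graph.
Row : ℕ → Caps v → (Fin v → ℕ) → Vec (Fin 3) v → Set
Row c cs d r = (∀ x → toℕ (lookup r x) ≤ 1) × ∑ʳ r ≤ c × (∀ x → toℕ (lookup r x) + d x ≤ toℕ (lookup cs x))

row? : ∀ c (cs : Caps v) d r → Dec (Row c cs d r)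
row? c cs d r = all? (λ x → toℕ (lookup r x) ≤? 1) ×-dec ((∑ʳ r ≤? c) ×-dec
                all? (λ x → toℕ (lookup r x) + d x ≤? toℕ (lookup cs x)))

module _ (c : ℕ) (z : Fin 3) (zs : Caps v) (d : Fin (suc v) → ℕ) (r : Vec (Fin 3) v) where

  row-0 : [ row? c (z ∷ zs) d (zero ∷ r) ] ≡ [ d zero ≤? toℕ z ] * [ row? c zs (d ∘ suc) r ]
  row-0 = trans
    ([]-⇔ (row? c (z ∷ zs) d (zero ∷ r)) ((d zero ≤? toℕ z) ×-dec row? c zs (d ∘ suc) r)
      (λ { (p , q , s) → s zero , p ∘ suc , subst (_≤ c) (∑ʳ-∷ zero r) q , s ∘ suc })
      (λ { (t , p , q , s) → (λ { zero → z≤n ; (suc x) → p x })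
                           , subst (_≤ c) (sym (∑ʳ-∷ zero r)) q
                           , (λ { zero → t ; (suc x) → s x }) }))
    ([]-× (d zero ≤? toℕ z) (row? c zs (d ∘ suc) r))

  row-2 : [ row? c (z ∷ zs) d (suc (suc zero) ∷ r) ] ≡ 0
  row-2 = []-no (row? c (z ∷ zs) d (suc (suc zero) ∷ r)) λ { (p , _) → contradiction (p zero) λ { (s≤s ()) } }

row-1 : ∀ c z (zs : Caps v) d r →
        [ row? (suc c) (suc z ∷ zs) d (suc zero ∷ r) ]
          ≡ [ d zero ≤? toℕ (inject₁ z) ] * [ row? c zs (d ∘ suc) r ]
row-1 c z zs d r = trans
  ([]-⇔ (row? (suc c) (suc z ∷ zs) d (suc zero ∷ r)) ((d zero ≤? toℕ (inject₁ z)) ×-dec row? c zs (d ∘ suc) r)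
    (λ { (p , q , s) → subst (d zero ≤_) (sym (toℕ-inject₁ z)) (≤-pred (s zero)) , p ∘ suc
                     , ≤-pred (subst (_≤ suc c) (∑ʳ-∷ (suc zero) r) q) , s ∘ suc })
    (λ { (t , p , q , s) → (λ { zero → ≤-refl ; (suc x) → p x })
                         , subst (_≤ suc c) (sym (∑ʳ-∷ (suc zero) r)) (s≤s q)
                         , (λ { zero → s≤s (subst (d zero ≤_) (toℕ-inject₁ z) t) ; (suc x) → s x }) }))
  ([]-× (d zero ≤? toℕ (inject₁ z)) (row? c zs (d ∘ suc) r))

row-1-full : ∀ c (zs : Caps v) d r → [ row? c (zero ∷ zs) d (suc zero ∷ r) ] ≡ 0
row-1-full c zs d r = []-no (row? c (zero ∷ zs) d (suc zero ∷ r)) λ { (_ , _ , s) → contradiction (s zero) λ () }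

row-1-spent : ∀ z (zs : Caps v) d r → [ row? 0 (z ∷ zs) d (suc zero ∷ r) ] ≡ 0
row-1-spent z zs d r = []-no (row? 0 (z ∷ zs) d (suc zero ∷ r))
  λ { (_ , q , _) → contradiction (subst (_≤ 0) (∑ʳ-∷ (suc zero) r) q) λ () }

-- A neighbour's degree grows by one, and `1 + d x ≤ suc z` says the same as `d x ≤ z`: the edge is
-- charged to the capacity instead of the degree. Entry 0 keeps the capacity, entry 1 lowers it and
-- spends one unit of `c`, entry 2 is excluded.
∑-rows : ∀ c (cs : Caps v) (d : Fin v → ℕ) →
         ∑ (allVecs (allFin 3) v) (λ r → [ row? c cs d r ]) ≡ ∑-nbhd c cs (λ ds → [ fits? d ds ])
∑-rows {zero} c [] d = trans (+-identityʳ _) ([]-⇔ (row? c [] d []) (fits? d []) (λ _ ()) (λ _ → (λ ()) , z≤n , λ ()))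
∑-rows {suc v} c (z ∷ zs) d = begin
  ∑ (allVecs (allFin 3) (suc v)) (λ r → [ row? c (z ∷ zs) d r ])
    ≡⟨ ∑-allVecs (allFin 3) v _ ⟩
  S zero + (S (suc zero) + (S (suc (suc zero)) + 0))
    ≡⟨ cong (λ t → S zero + (S (suc zero) + (t + 0))) (trans (∑-cong rows (row-2 c z zs d)) (∑-0 rows)) ⟩
  S zero + (S (suc zero) + 0)
    ≡⟨ cong (S zero +_) (+-identityʳ _) ⟩
  S zero + S (suc zero)
    ≡⟨ cong (_+ S (suc zero)) S-zero ⟩
  keep + S (suc zero)
    ≡⟨ step c z refl refl ⟩
  ∑-nbhd c (z ∷ zs) (λ ds → [ fits? d ds ]) ∎
  where
  open ≡-Reasoning
  rows = allVecs (allFin 3) v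
  S : Fin 3 → ℕ
  S e = ∑ rows (λ r → [ row? c (z ∷ zs) d (e ∷ r) ])
  keep : ℕ
  keep = ∑-nbhd c zs (λ ds → [ fits? d (z ∷ ds) ])
  shrink : ∀ c y → [ d zero ≤? toℕ y ] * ∑ rows (λ r → [ row? c zs (d ∘ suc) r ])
                     ≡ ∑-nbhd c zs (λ ds → [ fits? d (y ∷ ds) ])
  shrink c y = begin
    [ d zero ≤? toℕ y ] * ∑ rows (λ r → [ row? c zs (d ∘ suc) r ])
      ≡⟨ cong ([ d zero ≤? toℕ y ] *_) (∑-rows c zs (d ∘ suc)) ⟩
    [ d zero ≤? toℕ y ] * ∑-nbhd c zs (λ ds → [ fits? (d ∘ suc) ds ])
      ≡⟨ ∑-nbhd-*ˡ c zs [ d zero ≤? toℕ y ] _ ⟨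
    ∑-nbhd c zs (λ ds → [ d zero ≤? toℕ y ] * [ fits? (d ∘ suc) ds ])
      ≡⟨ ∑-nbhd-cong c zs (λ ds → sym (fits-∷ d y ds)) ⟩
    ∑-nbhd c zs (λ ds → [ fits? d (y ∷ ds) ]) ∎
  S-zero : S zero ≡ keep
  S-zero = trans (∑-cong rows (row-0 c z zs d)) (trans (∑-*ˡ rows [ d zero ≤? toℕ z ] _) (shrink c z))
  -- The split follows the clauses of `∑-nbhd`; the equations carry it over to `keep` and `S`, which
  -- are formed from the original `c` and `z`.
  step : ∀ c' z' → c' ≡ c → z' ≡ z → keep + S (suc zero) ≡ ∑-nbhd c' (z' ∷ zs) (λ ds → [ fits? d ds ])
  step c zero refl refl =
    trans (cong (keep +_) (trans (∑-cong rows (row-1-full c zs d)) (∑-0 rows))) (+-identityʳ keep)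
  step zero (suc z) refl refl =
    trans (cong (keep +_) (trans (∑-cong rows (row-1-spent (suc z) zs d)) (∑-0 rows))) (+-identityʳ keep)
  step (suc c) (suc z) refl refl =
    cong (keep +_) (trans (∑-cong rows (row-1 c z zs d)) (trans (∑-*ˡ rows [ d zero ≤? toℕ (inject₁ z) ] _) (shrink c (inject₁ z))))

-- Simple graphs and the deletion of a vertex

Simple : Mult v → Set
Simple M = (∀ x y → mult M x y ≡ mult M y x) × (∀ x → mult M x x ≡ 0) × NoDouble M

simple? : (M : Mult v) → Dec (Simple M)
simple? M = (all? λ x → all? λ y → mult M x y ≟ mult M y x)
            ×-dec ((all? λ x → mult M x x ≟ 0)
            ×-dec (all? λ x → all? λ y → mult M x y ≤? 1))

-- Simplicity is kept apart from the capacities: when a vertex is deleted, the same remaining graph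
-- is tested against varying capacities, and `[ simple? M ]` factors out.
graph? : (cs : Caps v) (M : Mult v) → Dec (Simple M × Fits (deg M) cs)
graph? cs M = simple? M ×-dec fits? (deg M) cs

#graphs : Caps v → ℕ
#graphs {v} cs = ∑ (allMult v) (λ M → [ graph? cs M ])

rowEnumeration : ∀ v → Enumeration (Vec (Fin 3) v)
rowEnumeration = vecEnumeration (finEnumeration 3)

multEnumeration : ∀ v → Enumeration (Mult v)
multEnumeration v = vecEnumeration (rowEnumeration v) v

addVertex : Vec (Fin 3) v × Mult v → Mult (suc v)
addVertex (r , M) = (zero ∷ r) ∷ zipWith _∷_ r M

deleteVertex : Mult (suc v) → Vec (Fin 3) v × Mult v
deleteVertex M = tail (head M) , Vec.map tail (tail M)

deleteVertex-addVertex : ∀ (p : Vec (Fin 3) v × Mult v) → deleteVertex (addVertex p) ≡ p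
deleteVertex-addVertex (r , M) = cong (r ,_) (map-tail r M)
  where
  map-tail : ∀ {u w} (r : Vec (Fin 3) u) (M : Vec (Vec (Fin 3) w) u) → Vec.map tail (zipWith _∷_ r M) ≡ M
  map-tail []      []      = refl
  map-tail (e ∷ r) (m ∷ M) = cong (m ∷_) (map-tail r M)

-- Deletion forgets the first column and the corner entry. Symmetry recovers the column from the
-- row, looplessness the corner.
addVertex-deleteVertex : ∀ (M : Mult (suc v)) → Simple M → addVertex (deleteVertex M) ≡ M
addVertex-deleteVertex ((e ∷ r) ∷ rows) (symm , loopless , _) =
  cong₂ _∷_ (cong (_∷ r) (toℕ-injective (sym (loopless zero))))
            (zip-tails r rows (λ x → toℕ-injective (symm zero (suc x))))
  where
  zip-tails : ∀ {u w} (r : Vec (Fin 3) u) (rows : Vec (Vec (Fin 3) (suc w)) u) →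
              (∀ x → lookup r x ≡ lookup (lookup rows x) zero) →
              zipWith _∷_ r (Vec.map tail rows) ≡ rows
  zip-tails []      []                   eq = refl
  zip-tails (e ∷ r) ((e' ∷ row) ∷ rows) eq = cong₂ _∷_ (cong (_∷ row) (eq zero)) (zip-tails r rows (eq ∘ suc))

module _ (r : Vec (Fin 3) v) (M : Mult v) where
  private
    M⁺ : Mult (suc v)
    M⁺ = addVertex (r , M)

  mult-new : ∀ x → mult M⁺ (suc x) zero ≡ toℕ (lookup r x)
  mult-new x = cong (λ row → toℕ (lookup row zero)) (Vec.lookup-zipWith _∷_ x r M)

  mult-old : ∀ x y → mult M⁺ (suc x) (suc y) ≡ mult M x y
  mult-old x y = cong (λ row → toℕ (lookup row (suc y))) (Vec.lookup-zipWith _∷_ x r M)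

  deg-new : deg M⁺ zero ≡ ∑ʳ r
  deg-new = ∑ʳ-∷ zero r

  deg-old : ∀ x → deg M⁺ (suc x) ≡ toℕ (lookup r x) + deg M x
  deg-old x = trans (∑-allFin v (mult M⁺ (suc x))) (cong₂ _+_ (mult-new x) (∑-cong (allFin v) (mult-old x)))

  graph-addVertex : ∀ c (cs : Caps v) →
    [ graph? (c ∷ cs) M⁺ ] ≡ [ simple? M ] * [ row? (toℕ c) cs (deg M) r ]
  graph-addVertex c cs = trans
    ([]-⇔ (graph? (c ∷ cs) M⁺) (simple? M ×-dec row? (toℕ c) cs (deg M) r) restrict extend)
    ([]-× (simple? M) (row? (toℕ c) cs (deg M) r))
    where
    restrict : Simple M⁺ × Fits (deg M⁺) (c ∷ cs) → Simple M × Row (toℕ c) cs (deg M) r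
    restrict ((symm , loopless , single) , fits) =
      ( (λ x y → trans (sym (mult-old x y)) (trans (symm (suc x) (suc y)) (mult-old y x)))
      , (λ x → trans (sym (mult-old x x)) (loopless (suc x)))
      , (λ x y → subst (_≤ 1) (mult-old x y) (single (suc x) (suc y))) )
      , (λ x → single zero (suc x))
      , subst (_≤ toℕ c) deg-new (fits zero)
      , (λ x → subst (_≤ toℕ (lookup cs x)) (deg-old x) (fits (suc x)))
    extend : Simple M × Row (toℕ c) cs (deg M) r → Simple M⁺ × Fits (deg M⁺) (c ∷ cs)
    extend ((symm , loopless , single) , single-r , deg-r , fits) =
      ( (λ { zero zero → refl
           ; zero (suc y) → sym (mult-new y)
           ; (suc x) zero → mult-new x
           ; (suc x) (suc y) → trans (mult-old x y) (trans (symm x y) (sym (mult-old y x))) })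
      , (λ { zero → refl ; (suc x) → trans (mult-old x x) (loopless x) })
      , (λ { zero zero → z≤n
           ; zero (suc y) → single-r y
           ; (suc x) zero → subst (_≤ 1) (sym (mult-new x)) (single-r x)
           ; (suc x) (suc y) → subst (_≤ 1) (sym (mult-old x y)) (single x y) }) )
      , (λ { zero → subst (_≤ toℕ c) (sym deg-new) deg-r
           ; (suc x) → subst (_≤ toℕ (lookup cs x)) (sym (deg-old x)) (fits x) })

[]-≢0 : {P : Set} (P? : Dec P) → [ P? ] ≢ 0 → P
[]-≢0 (yes p) _  = p
[]-≢0 (no _) ≢0 = contradiction refl ≢0

-- A graph is its first row together with the graph `M` on the other vertices. For fixed `M` the sum
-- over rows is `∑-rows` with `d = deg M`, hence the exchange of the two sums.
#graphs-∷ : ∀ c (cs : Caps v) → #graphs (c ∷ cs) ≡ ∑-nbhd (toℕ c) cs #graphs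
#graphs-∷ {v} c cs = begin
  #graphs (c ∷ cs)
    ≡⟨ ∑-reindex (multEnumeration (suc v)) (×-enumeration (rowEnumeration v) (multEnumeration v))
         addVertex deleteVertex deleteVertex-addVertex (λ M → [ graph? (c ∷ cs) M ])
         (λ M ≢0 → addVertex-deleteVertex M (proj₁ ([]-≢0 (graph? (c ∷ cs) M) ≢0))) ⟩
  ∑ (Enumeration.elements (×-enumeration (rowEnumeration v) (multEnumeration v))) (λ p → [ graph? (c ∷ cs) (addVertex p) ])
    ≡⟨ ∑-cartesianProduct rows (allMult v) _ ⟩
  ∑ rows (λ r → ∑ (allMult v) (λ M → [ graph? (c ∷ cs) (addVertex (r , M)) ]))
    ≡⟨ ∑-swap rows (allMult v) _ ⟩
  ∑ (allMult v) (λ M → ∑ rows (λ r → [ graph? (c ∷ cs) (addVertex (r , M)) ]))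
    ≡⟨ ∑-cong (allMult v) remove ⟩
  ∑ (allMult v) (λ M → ∑-nbhd (toℕ c) cs (λ ds → [ graph? ds M ]))
    ≡⟨ ∑-nbhd-∑ (toℕ c) cs (allMult v) _ ⟨
  ∑-nbhd (toℕ c) cs #graphs ∎
  where
  open ≡-Reasoning
  rows = allVecs (allFin 3) v
  remove : ∀ M → ∑ rows (λ r → [ graph? (c ∷ cs) (addVertex (r , M)) ])
                   ≡ ∑-nbhd (toℕ c) cs (λ ds → [ graph? ds M ])
  remove M = begin
    ∑ rows (λ r → [ graph? (c ∷ cs) (addVertex (r , M)) ])
      ≡⟨ ∑-cong rows (λ r → graph-addVertex r M c cs) ⟩
    ∑ rows (λ r → [ simple? M ] * [ row? (toℕ c) cs (deg M) r ])
      ≡⟨ ∑-*ˡ rows [ simple? M ] _ ⟩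
    [ simple? M ] * ∑ rows (λ r → [ row? (toℕ c) cs (deg M) r ])
      ≡⟨ cong ([ simple? M ] *_) (∑-rows (toℕ c) cs (deg M)) ⟩
    [ simple? M ] * ∑-nbhd (toℕ c) cs (λ ds → [ fits? (deg M) ds ])
      ≡⟨ ∑-nbhd-*ˡ (toℕ c) cs [ simple? M ] _ ⟨
    ∑-nbhd (toℕ c) cs (λ ds → [ simple? M ] * [ fits? (deg M) ds ])
      ≡⟨ ∑-nbhd-cong (toℕ c) cs (λ ds → sym ([]-× (simple? M) (fits? (deg M) ds))) ⟩
    ∑-nbhd (toℕ c) cs (λ ds → [ graph? ds M ]) ∎

-- Independence of the order of the vertices

pattern one = suc zero
pattern two = suc (suc zero)

∑-nbhd-0 : ∀ (cs : Caps v) k → ∑-nbhd 0 cs k ≡ k cs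
∑-nbhd-0 []           k = refl
∑-nbhd-0 (zero ∷ cs)  k = ∑-nbhd-0 cs _
∑-nbhd-0 (suc z ∷ cs) k = ∑-nbhd-0 cs _

-- Both sides choose neighbourhoods for two new vertices that are not joined to each other. An old
-- vertex of capacity 2 is chosen by neither, one, the other or both, and the two middle cases trade
-- places; at capacity 1 the last case is missing.
∑-nbhd-comm : ∀ c c' (cs : Caps v) k →
              ∑-nbhd c cs (λ ds → ∑-nbhd c' ds k) ≡ ∑-nbhd c' cs (λ ds → ∑-nbhd c ds k)
∑-nbhd-comm zero c' cs k =
  trans (∑-nbhd-0 cs _) (∑-nbhd-cong c' cs (λ ds → sym (∑-nbhd-0 ds k)))
∑-nbhd-comm (suc c) zero cs k =
  trans (∑-nbhd-cong (suc c) cs (λ ds → ∑-nbhd-0 ds k)) (sym (∑-nbhd-0 cs _))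
∑-nbhd-comm (suc c) (suc c') []          k = refl
∑-nbhd-comm (suc c) (suc c') (zero ∷ cs) k = ∑-nbhd-comm (suc c) (suc c') cs _
∑-nbhd-comm (suc c) (suc c') (one ∷ cs)  k
  rewrite ∑-nbhd-+ (suc c) cs (λ ds → ∑-nbhd (suc c') ds (k ∘ (one ∷_))) (λ ds → ∑-nbhd c' ds (k ∘ (zero ∷_)))
        | ∑-nbhd-+ (suc c') cs (λ ds → ∑-nbhd (suc c) ds (k ∘ (one ∷_))) (λ ds → ∑-nbhd c ds (k ∘ (zero ∷_)))
        | ∑-nbhd-comm (suc c) (suc c') cs (k ∘ (one ∷_))
        | ∑-nbhd-comm (suc c) c' cs (k ∘ (zero ∷_))
        | ∑-nbhd-comm c (suc c') cs (k ∘ (zero ∷_))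
  = xy∙z≈xz∙y (∑-nbhd (suc c') cs (λ ds → ∑-nbhd (suc c) ds (k ∘ (one ∷_)))) _ _
∑-nbhd-comm (suc c) (suc c') (two ∷ cs)  k
  rewrite ∑-nbhd-+ (suc c) cs (λ ds → ∑-nbhd (suc c') ds (k ∘ (two ∷_))) (λ ds → ∑-nbhd c' ds (k ∘ (one ∷_)))
        | ∑-nbhd-+ (suc c') cs (λ ds → ∑-nbhd (suc c) ds (k ∘ (two ∷_))) (λ ds → ∑-nbhd c ds (k ∘ (one ∷_)))
        | ∑-nbhd-+ c cs (λ ds → ∑-nbhd (suc c') ds (k ∘ (one ∷_))) (λ ds → ∑-nbhd c' ds (k ∘ (zero ∷_)))
        | ∑-nbhd-+ c' cs (λ ds → ∑-nbhd (suc c) ds (k ∘ (one ∷_))) (λ ds → ∑-nbhd c ds (k ∘ (zero ∷_)))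
        | ∑-nbhd-comm (suc c) (suc c') cs (k ∘ (two ∷_))
        | ∑-nbhd-comm (suc c) c' cs (k ∘ (one ∷_))
        | ∑-nbhd-comm c (suc c') cs (k ∘ (one ∷_))
        | ∑-nbhd-comm c c' cs (k ∘ (zero ∷_))
  = interchange (∑-nbhd (suc c') cs (λ ds → ∑-nbhd (suc c) ds (k ∘ (two ∷_)))) _ _ _

-- The two summands separate the graphs in which the leading vertices are not adjacent from those in
-- which they are; in the latter, capacities 0 and 1 are left to them.
#graphs-swap : ∀ (cs : Caps v) → #graphs (one ∷ two ∷ cs) ≡ #graphs (two ∷ one ∷ cs)
#graphs-swap cs = begin
  #graphs (one ∷ two ∷ cs)
    ≡⟨ #graphs-∷ one (two ∷ cs) ⟩
  ∑-nbhd 1 cs (λ ds → #graphs (two ∷ ds)) + ∑-nbhd 0 cs (λ ds → #graphs (one ∷ ds))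
    ≡⟨ cong₂ _+_ (∑-nbhd-cong 1 cs (#graphs-∷ two)) (∑-nbhd-cong 0 cs (#graphs-∷ one)) ⟩
  ∑-nbhd 1 cs (λ ds → ∑-nbhd 2 ds #graphs) + ∑-nbhd 0 cs (λ ds → ∑-nbhd 1 ds #graphs)
    ≡⟨ cong₂ _+_ (∑-nbhd-comm 1 2 cs #graphs) (∑-nbhd-comm 0 1 cs #graphs) ⟩
  ∑-nbhd 2 cs (λ ds → ∑-nbhd 1 ds #graphs) + ∑-nbhd 1 cs (λ ds → ∑-nbhd 0 ds #graphs)
    ≡⟨ cong₂ _+_ (∑-nbhd-cong 2 cs (#graphs-∷ one)) (∑-nbhd-cong 1 cs (#graphs-∷ zero)) ⟨
  ∑-nbhd 2 cs (λ ds → #graphs (one ∷ ds)) + ∑-nbhd 1 cs (λ ds → #graphs (zero ∷ ds))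
    ≡⟨ #graphs-∷ two (one ∷ cs) ⟨
  #graphs (two ∷ one ∷ cs) ∎
  where open ≡-Reasoning

-- Dependence on the numbers of capacities 1 and 2

ones twos : Caps v → ℕ
ones []          = 0
ones (zero ∷ cs) = ones cs
ones (one ∷ cs)  = suc (ones cs)
ones (two ∷ cs)  = ones cs
twos []          = 0
twos (zero ∷ cs) = twos cs
twos (one ∷ cs)  = twos cs
twos (two ∷ cs)  = suc (twos cs)

onCounts : (ℕ → ℕ → ℕ) → Caps v → ℕ
onCounts φ cs = φ (ones cs) (twos cs)

-- Multiplication of the exponential generating function by its variable; it also
-- counts the ways to pick one of n vertices and delete it.
δ : (ℕ → ℕ) → ℕ → ℕ
δ ψ zero    = 0
δ ψ (suc n) = suc n * ψ n

-- Sum over the ways to lower one capacity by one, for a vertices of capacity 1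
-- and b of capacity 2.
D : (ℕ → ℕ → ℕ) → ℕ → ℕ → ℕ
D φ a b = δ (λ a' → φ a' b) a + δ (φ (suc a)) b

δ-cong : ∀ {φ ψ : ℕ → ℕ} → φ ≗ ψ → δ φ ≗ δ ψ
δ-cong φ≗ψ zero    = refl
δ-cong φ≗ψ (suc n) = cong (suc n *_) (φ≗ψ n)

δ-+ : ∀ φ ψ n → δ (λ m → φ m + ψ m) n ≡ δ φ n + δ ψ n
δ-+ φ ψ zero    = refl
δ-+ φ ψ (suc n) = *-distribˡ-+ (suc n) (φ n) (ψ n)

δ-*ˡ : ∀ c φ n → δ (λ m → c * φ m) n ≡ c * δ φ n
δ-*ˡ c φ zero    = sym (*-zeroʳ c)
δ-*ˡ c φ (suc n) = swap (suc n) c (φ n)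
  where
  swap : ∀ x y z → x * (y * z) ≡ y * (x * z)
  swap = solve-∀

-- δ (φ ∘ suc) n is n * φ n.
δ-suc : ∀ φ n → suc n * φ n ≡ δ (φ ∘ suc) n + φ n
δ-suc φ zero    = *-identityˡ (φ 0)
δ-suc φ (suc n) = +-comm (φ (suc n)) (suc n * φ (suc n))

D-cong : ∀ {φ ψ : ℕ → ℕ → ℕ} → (∀ a b → φ a b ≡ ψ a b) → ∀ a b → D φ a b ≡ D ψ a b
D-cong eq a b = cong₂ _+_ (δ-cong (λ a' → eq a' b) a) (δ-cong (eq (suc a)) b)

D-+ : ∀ φ ψ a b → D (λ a b → φ a b + ψ a b) a b ≡ D φ a b + D ψ a b
D-+ φ ψ a b rewrite δ-+ (λ a' → φ a' b) (λ a' → ψ a' b) a | δ-+ (φ (suc a)) (ψ (suc a)) b =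
  interchange (δ (λ a' → φ a' b) a) _ _ _

_₁ _₂ : (ℕ → ℕ → ℕ) → ℕ → ℕ → ℕ
(φ ₁) a b = φ (suc a) b
(φ ₂) a b = φ a (suc b)

-- Here and in `D-₂` one vertex is singled out. The last term is the case where that vertex is the
-- lowered one: capacity 1 disappears, capacity 2 turns into capacity 1.
D-₁ : ∀ φ a b → D φ (suc a) b ≡ D (φ ₁) a b + φ a b
D-₁ φ a b = trans (cong (_+ δ (φ (suc (suc a))) b) (δ-suc (λ a' → φ a' b) a))
                  (xy∙z≈xz∙y (δ (λ a' → φ (suc a') b) a) (φ a b) (δ (φ (suc (suc a))) b))

D-₂ : ∀ φ a b → D φ a (suc b) ≡ D (φ ₂) a b + φ (suc a) b
D-₂ φ a b = trans (cong (δ (λ a' → φ a' (suc b)) a +_) (δ-suc (φ (suc a)) b)) (sym (+-assoc (δ (λ a' → φ a' (suc b)) a) _ _))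

DD-₁ : ∀ φ a b → D (D φ) (suc a) b ≡ D (D (φ ₁)) a b + 2 * D φ a b
DD-₁ φ a b = begin
  D (D φ) (suc a) b                       ≡⟨ D-₁ (D φ) a b ⟩
  D ((D φ) ₁) a b + D φ a b               ≡⟨ cong (_+ D φ a b) (D-cong (D-₁ φ) a b) ⟩
  D (λ a b → D (φ ₁) a b + φ a b) a b + D φ a b ≡⟨ cong (_+ D φ a b) (D-+ (D (φ ₁)) φ a b) ⟩
  D (D (φ ₁)) a b + D φ a b + D φ a b     ≡⟨ double (D (D (φ ₁)) a b) (D φ a b) ⟩
  D (D (φ ₁)) a b + 2 * D φ a b           ∎
  where
  open ≡-Reasoning
  double : ∀ x y → x + y + y ≡ x + 2 * y
  double = solve-∀

-- The singled-out vertex is lowered not at all, once (in the first or the second step), or twice.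
-- The final `φ a b` is the last case, which a vertex of capacity 1 does not have.
DD-₂ : ∀ φ a b → D (D φ) a (suc b) ≡ D (D (φ ₂)) a b + 2 * D (φ ₁) a b + φ a b
DD-₂ φ a b = begin
  D (D φ) a (suc b)                       ≡⟨ D-₂ (D φ) a b ⟩
  D ((D φ) ₂) a b + D φ (suc a) b         ≡⟨ cong₂ _+_ (D-cong (D-₂ φ) a b) (D-₁ φ a b) ⟩
  D (λ a b → D (φ ₂) a b + (φ ₁) a b) a b + (D (φ ₁) a b + φ a b) ≡⟨ cong (_+ (D (φ ₁) a b + φ a b)) (D-+ (D (φ ₂)) (φ ₁) a b) ⟩
  D (D (φ ₂)) a b + D (φ ₁) a b + (D (φ ₁) a b + φ a b) ≡⟨ double (D (D (φ ₂)) a b) (D (φ ₁) a b) (φ a b) ⟩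
  D (D (φ ₂)) a b + 2 * D (φ ₁) a b + φ a b ∎
  where
  open ≡-Reasoning
  double : ∀ x y z → x + y + (y + z) ≡ x + 2 * y + z
  double = solve-∀

-- The neighbourhood is empty, giving `φ a b`, or a single vertex, giving `D φ a b`.
∑-nbhd-1 : ∀ φ (cs : Caps v) → ∑-nbhd 1 cs (onCounts φ) ≡ onCounts (λ a b → φ a b + D φ a b) cs
∑-nbhd-1 φ []          = sym (+-identityʳ _)
∑-nbhd-1 φ (zero ∷ cs) = ∑-nbhd-1 φ cs
∑-nbhd-1 φ (one ∷ cs)  = begin
  ∑-nbhd 1 cs (onCounts (φ ₁)) + ∑-nbhd 0 cs (onCounts φ)
    ≡⟨ cong₂ _+_ (∑-nbhd-1 (φ ₁) cs) (∑-nbhd-0 cs _) ⟩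
  φ (suc a) b + D (φ ₁) a b + φ a b
    ≡⟨ +-assoc (φ (suc a) b) _ _ ⟩
  φ (suc a) b + (D (φ ₁) a b + φ a b)
    ≡⟨ cong (φ (suc a) b +_) (D-₁ φ a b) ⟨
  φ (suc a) b + D φ (suc a) b ∎
  where
  open ≡-Reasoning
  a = ones cs
  b = twos cs
∑-nbhd-1 φ (two ∷ cs)  = begin
  ∑-nbhd 1 cs (onCounts (φ ₂)) + ∑-nbhd 0 cs (onCounts (φ ₁))
    ≡⟨ cong₂ _+_ (∑-nbhd-1 (φ ₂) cs) (∑-nbhd-0 cs _) ⟩
  φ a (suc b) + D (φ ₂) a b + φ (suc a) b
    ≡⟨ +-assoc (φ a (suc b)) _ _ ⟩
  φ a (suc b) + (D (φ ₂) a b + φ (suc a) b)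
    ≡⟨ cong (φ a (suc b) +_) (D-₂ φ a b) ⟨
  φ a (suc b) + D φ a (suc b) ∎
  where
  open ≡-Reasoning
  a = ones cs
  b = twos cs

-- D ∘ D counts ordered pairs of removed half-edges; those at one vertex of
-- capacity 2 are not neighbourhoods, whence the term δ (φ a) b.
∑-nbhd-2 : ∀ φ (cs : Caps v) →
  2 * ∑-nbhd 2 cs (onCounts φ) + onCounts (λ a b → δ (φ a) b) cs
    ≡ onCounts (λ a b → 2 * φ a b + 2 * D φ a b + D (D φ) a b) cs
∑-nbhd-2 φ []          = identity (φ 0 0)
  where
  identity : ∀ x → 2 * x + 0 ≡ 2 * x + 0 + 0
  identity = solve-∀
∑-nbhd-2 φ (zero ∷ cs) = ∑-nbhd-2 φ cs
∑-nbhd-2 φ (one ∷ cs)  = begin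
  2 * (∑-nbhd 2 cs (onCounts (φ ₁)) + ∑-nbhd 1 cs (onCounts φ)) + δ (φ (suc a)) b
    ≡⟨ cong (λ s → 2 * (∑-nbhd 2 cs (onCounts (φ ₁)) + s) + δ (φ (suc a)) b) (∑-nbhd-1 φ cs) ⟩
  2 * (∑-nbhd 2 cs (onCounts (φ ₁)) + (φ a b + D φ a b)) + δ (φ (suc a)) b
    ≡⟨ regroup (∑-nbhd 2 cs (onCounts (φ ₁))) (φ a b + D φ a b) (δ (φ (suc a)) b) ⟩
  2 * ∑-nbhd 2 cs (onCounts (φ ₁)) + δ (φ (suc a)) b + 2 * (φ a b + D φ a b)
    ≡⟨ cong (_+ 2 * (φ a b + D φ a b)) (∑-nbhd-2 (φ ₁) cs) ⟩
  2 * φ (suc a) b + 2 * D (φ ₁) a b + D (D (φ ₁)) a b + 2 * (φ a b + D φ a b)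
    ≡⟨ collect (φ (suc a) b) (D (φ ₁) a b) (D (D (φ ₁)) a b) (φ a b) (D φ a b) ⟩
  2 * φ (suc a) b + 2 * (D (φ ₁) a b + φ a b) + (D (D (φ ₁)) a b + 2 * D φ a b)
    ≡⟨ cong₂ (λ x y → 2 * φ (suc a) b + 2 * x + y) (D-₁ φ a b) (DD-₁ φ a b) ⟨
  2 * φ (suc a) b + 2 * D φ (suc a) b + D (D φ) (suc a) b ∎
  where
  open ≡-Reasoning
  a = ones cs
  b = twos cs
  regroup : ∀ x y z → 2 * (x + y) + z ≡ 2 * x + z + 2 * y
  regroup = solve-∀
  collect : ∀ x y z u w → 2 * x + 2 * y + z + 2 * (u + w) ≡ 2 * x + 2 * (y + u) + (z + 2 * w)
  collect = solve-∀
∑-nbhd-2 φ (two ∷ cs)  = begin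
  2 * (∑-nbhd 2 cs (onCounts (φ ₂)) + ∑-nbhd 1 cs (onCounts (φ ₁))) + suc b * φ a b
    ≡⟨ cong₂ (λ s u → 2 * (∑-nbhd 2 cs (onCounts (φ ₂)) + s) + u) (∑-nbhd-1 (φ ₁) cs) (δ-suc (φ a) b) ⟩
  2 * (∑-nbhd 2 cs (onCounts (φ ₂)) + (φ (suc a) b + D (φ ₁) a b)) + (δ (φ a ∘ suc) b + φ a b)
    ≡⟨ regroup (∑-nbhd 2 cs (onCounts (φ ₂))) (φ (suc a) b + D (φ ₁) a b) (δ (φ a ∘ suc) b) (φ a b) ⟩
  2 * ∑-nbhd 2 cs (onCounts (φ ₂)) + δ (φ a ∘ suc) b + (2 * (φ (suc a) b + D (φ ₁) a b) + φ a b)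
    ≡⟨ cong (_+ (2 * (φ (suc a) b + D (φ ₁) a b) + φ a b)) (∑-nbhd-2 (φ ₂) cs) ⟩
  2 * φ a (suc b) + 2 * D (φ ₂) a b + D (D (φ ₂)) a b + (2 * (φ (suc a) b + D (φ ₁) a b) + φ a b)
    ≡⟨ collect (φ a (suc b)) (D (φ ₂) a b) (D (D (φ ₂)) a b) (φ (suc a) b) (D (φ ₁) a b) (φ a b) ⟩
  2 * φ a (suc b) + 2 * (D (φ ₂) a b + φ (suc a) b) + (D (D (φ ₂)) a b + 2 * D (φ ₁) a b + φ a b)
    ≡⟨ cong₂ (λ x y → 2 * φ a (suc b) + 2 * x + y) (D-₂ φ a b) (DD-₂ φ a b) ⟨
  2 * φ a (suc b) + 2 * D φ a (suc b) + D (D φ) a (suc b) ∎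
  where
  open ≡-Reasoning
  a = ones cs
  b = twos cs
  regroup : ∀ x y z u → 2 * (x + y) + (z + u) ≡ 2 * x + z + (2 * y + u)
  regroup = solve-∀
  collect : ∀ x y z u w t → 2 * x + 2 * y + z + (2 * (u + w) + t) ≡ 2 * x + 2 * (y + u) + (z + 2 * w + t)
  collect = solve-∀

∑-nbhd-counts : ∀ c φ (cs : Caps v) (ds : Caps w) → ones cs ≡ ones ds → twos cs ≡ twos ds →
                ∑-nbhd (toℕ {3} c) cs (onCounts φ) ≡ ∑-nbhd (toℕ c) ds (onCounts φ)
∑-nbhd-counts zero φ cs ds eq₁ eq₂ =
  trans (∑-nbhd-0 cs _) (trans (cong₂ φ eq₁ eq₂) (sym (∑-nbhd-0 ds _)))
∑-nbhd-counts one φ cs ds eq₁ eq₂ =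
  trans (∑-nbhd-1 φ cs) (trans (cong₂ (λ a b → φ a b + D φ a b) eq₁ eq₂) (sym (∑-nbhd-1 φ ds)))
∑-nbhd-counts two φ cs ds eq₁ eq₂ =
  -- `∑-nbhd-2` yields only twice the sum plus a correction. The correction is itself a function of
  -- the two numbers, so it can be cancelled, and then the factor 2.
  *-cancelˡ-≡ _ _ 2 (+-cancelʳ-≡ (onCounts (λ a b → δ (φ a) b) ds) _ _ (begin
    2 * ∑-nbhd 2 cs (onCounts φ) + onCounts (λ a b → δ (φ a) b) ds
      ≡⟨ cong₂ (λ a b → 2 * ∑-nbhd 2 cs (onCounts φ) + δ (φ a) b) eq₁ eq₂ ⟨
    2 * ∑-nbhd 2 cs (onCounts φ) + onCounts (λ a b → δ (φ a) b) cs
      ≡⟨ ∑-nbhd-2 φ cs ⟩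
    onCounts (λ a b → 2 * φ a b + 2 * D φ a b + D (D φ) a b) cs
      ≡⟨ cong₂ (λ a b → 2 * φ a b + 2 * D φ a b + D (D φ) a b) eq₁ eq₂ ⟩
    onCounts (λ a b → 2 * φ a b + 2 * D φ a b + D (D φ) a b) ds
      ≡⟨ ∑-nbhd-2 φ ds ⟨
    2 * ∑-nbhd 2 ds (onCounts φ) + onCounts (λ a b → δ (φ a) b) ds ∎))
  where open ≡-Reasoning

-- The graph count as a function of two numbers, and its recurrences

canonical : ∀ a b → Caps (a + b)
canonical zero    b = replicate b two
canonical (suc a) b = one ∷ canonical a b

ones-canonical : ∀ a b → ones (canonical a b) ≡ a
ones-canonical zero zero    = refl
ones-canonical zero (suc b) = ones-canonical zero b
ones-canonical (suc a) b    = cong suc (ones-canonical a b)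

twos-canonical : ∀ a b → twos (canonical a b) ≡ b
twos-canonical zero zero    = refl
twos-canonical zero (suc b) = cong suc (twos-canonical zero b)
twos-canonical (suc a) b    = twos-canonical a b

graphCount : ℕ → ℕ → ℕ
graphCount a b = #graphs (canonical a b)

ones+twos≤ : ∀ (cs : Caps v) → ones cs + twos cs ≤ v
ones+twos≤ []          = z≤n
ones+twos≤ (zero ∷ cs) = m≤n⇒m≤1+n (ones+twos≤ cs)
ones+twos≤ (one ∷ cs)  = s≤s (ones+twos≤ cs)
ones+twos≤ {suc v} (two ∷ cs)  = subst (_≤ suc v) (sym (+-suc (ones cs) (twos cs))) (s≤s (ones+twos≤ cs))

-- Induction on a bound for the number of vertices: the hypothesis is also needed for canonical
-- lists, which are not sublists of the given one but have no more vertices than its tail.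
#graphs-counts : ∀ n {v} → v ≤ n → (cs : Caps v) → #graphs cs ≡ onCounts graphCount cs
#graphs-counts n       v≤n       []       = refl
#graphs-counts (suc n) {suc v} (s≤s v≤n) (c ∷ cs) =
  trans (expand c cs v≤n) (first c (ones cs) (twos cs) cs refl refl (≤-trans (ones+twos≤ cs) v≤n))
  where
  open ≡-Reasoning
  expand : ∀ c {u} (ds : Caps u) → u ≤ n → #graphs (c ∷ ds) ≡ ∑-nbhd (toℕ c) ds (onCounts graphCount)
  expand c ds u≤n = trans (#graphs-∷ c ds) (∑-nbhd-cong (toℕ c) ds (#graphs-counts n u≤n))
  first : ∀ c a b {u} (ds : Caps u) → ones ds ≡ a → twos ds ≡ b → a + b ≤ n →
          ∑-nbhd (toℕ c) ds (onCounts graphCount) ≡ onCounts graphCount (c ∷ ds)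
  first zero a b ds refl refl _ = ∑-nbhd-0 ds _
  first one a b ds refl refl a+b≤n = begin
    ∑-nbhd 1 ds (onCounts graphCount)
      ≡⟨ ∑-nbhd-counts one graphCount ds (canonical a b) (sym (ones-canonical a b)) (sym (twos-canonical a b)) ⟩
    ∑-nbhd 1 (canonical a b) (onCounts graphCount)
      ≡⟨ expand one (canonical a b) a+b≤n ⟨
    graphCount (suc a) b ∎
  first two zero b ds ≡0 refl b≤n = begin
    ∑-nbhd 2 ds (onCounts graphCount)
      ≡⟨ ∑-nbhd-counts two graphCount ds (canonical 0 b) (trans ≡0 (sym (ones-canonical 0 b))) (sym (twos-canonical 0 b)) ⟩
    ∑-nbhd 2 (canonical 0 b) (onCounts graphCount)
      ≡⟨ expand two (canonical 0 b) b≤n ⟨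
    graphCount 0 (suc b)
      ≡⟨ cong (λ a → graphCount a (suc b)) ≡0 ⟨
    graphCount (ones ds) (suc b) ∎
  -- A canonical list with a capacity 1 cannot start with `two`. One `one` is brought to second
  -- place, the two leading vertices are exchanged, and the tail behind the new leading `one` is
  -- sorted.
  first two (suc a) b ds ≡1+a refl a+b≤n = begin
    ∑-nbhd 2 ds (onCounts graphCount)
      ≡⟨ ∑-nbhd-counts two graphCount ds (one ∷ canonical a b)
           (trans ≡1+a (cong suc (sym (ones-canonical a b)))) (sym (twos-canonical a b)) ⟩
    ∑-nbhd 2 (one ∷ canonical a b) (onCounts graphCount)
      ≡⟨ expand two (one ∷ canonical a b) a+b≤n ⟨
    #graphs (two ∷ one ∷ canonical a b)
      ≡⟨ #graphs-swap (canonical a b) ⟨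
    #graphs (one ∷ two ∷ canonical a b)
      ≡⟨ expand one (two ∷ canonical a b) a+b≤n ⟩
    ∑-nbhd 1 (two ∷ canonical a b) (onCounts graphCount)
      ≡⟨ ∑-nbhd-counts one graphCount (two ∷ canonical a b) (canonical a (suc b))
           (trans (ones-canonical a b) (sym (ones-canonical a (suc b))))
           (trans (cong suc (twos-canonical a b)) (sym (twos-canonical a (suc b)))) ⟩
    ∑-nbhd 1 (canonical a (suc b)) (onCounts graphCount)
      ≡⟨ expand one (canonical a (suc b)) (subst (_≤ n) (sym (+-suc a b)) a+b≤n) ⟨
    graphCount (suc a) (suc b)
      ≡⟨ cong (λ a → graphCount a (suc b)) ≡1+a ⟨
    graphCount (ones ds) (suc b) ∎

#graphs≡graphCount : ∀ (cs : Caps v) → #graphs cs ≡ onCounts graphCount cs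
#graphs≡graphCount = #graphs-counts _ ≤-refl

graphCount-rec₁ : ∀ a b → graphCount (suc a) b ≡ graphCount a b + D graphCount a b
graphCount-rec₁ a b = begin
  graphCount (suc a) b
    ≡⟨ #graphs-∷ one (canonical a b) ⟩
  ∑-nbhd 1 (canonical a b) #graphs
    ≡⟨ ∑-nbhd-cong 1 (canonical a b) #graphs≡graphCount ⟩
  ∑-nbhd 1 (canonical a b) (onCounts graphCount)
    ≡⟨ ∑-nbhd-1 graphCount (canonical a b) ⟩
  onCounts (λ a b → graphCount a b + D graphCount a b) (canonical a b)
    ≡⟨ cong₂ (λ a b → graphCount a b + D graphCount a b) (ones-canonical a b) (twos-canonical a b) ⟩
  graphCount a b + D graphCount a b ∎
  where open ≡-Reasoning

-- At a = 0 the twofold lowering `D (D graphCount)` contains `δ (graphCount 0) b`, from one vertex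
-- lowered twice; this is exactly the correction in `∑-nbhd-2`. What remains,
-- `δ (δ (graphCount 2)) b`, counts ordered pairs of distinct neighbours.
graphCount-rec₂ : ∀ b → 2 * graphCount 0 (suc b) ≡ 2 * graphCount 0 b + 2 * δ (graphCount 1) b + δ (δ (graphCount 2)) b
graphCount-rec₂ b = +-cancelʳ-≡ (δ (graphCount 0) b) _ _ (begin
  2 * graphCount 0 (suc b) + δ (graphCount 0) b
    ≡⟨ cong (λ s → 2 * s + δ (graphCount 0) b) (trans (#graphs-∷ two (canonical 0 b)) (∑-nbhd-cong 2 (canonical 0 b) #graphs≡graphCount)) ⟩
  2 * ∑-nbhd 2 (canonical 0 b) (onCounts graphCount) + δ (graphCount 0) b
    ≡⟨ cong₂ (λ x y → 2 * ∑-nbhd 2 (canonical 0 b) (onCounts graphCount) + δ (graphCount x) y) (ones-canonical 0 b) (twos-canonical 0 b) ⟨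
  2 * ∑-nbhd 2 (canonical 0 b) (onCounts graphCount) + onCounts (λ a b → δ (graphCount a) b) (canonical 0 b)
    ≡⟨ ∑-nbhd-2 graphCount (canonical 0 b) ⟩
  onCounts (λ a b → 2 * graphCount a b + 2 * D graphCount a b + D (D graphCount) a b) (canonical 0 b)
    ≡⟨ cong₂ (λ a b → 2 * graphCount a b + 2 * D graphCount a b + D (D graphCount) a b) (ones-canonical 0 b) (twos-canonical 0 b) ⟩
  2 * graphCount 0 b + 2 * δ (graphCount 1) b + δ (λ b → graphCount 0 b + 0 + δ (graphCount 2) b) b
    ≡⟨ cong (2 * graphCount 0 b + 2 * δ (graphCount 1) b +_)
         (trans (δ-cong (λ b → cong (_+ δ (graphCount 2) b) (+-identityʳ (graphCount 0 b))) b) (δ-+ (graphCount 0) (δ (graphCount 2)) b)) ⟩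
  2 * graphCount 0 b + 2 * δ (graphCount 1) b + (δ (graphCount 0) b + δ (δ (graphCount 2)) b)
    ≡⟨ exchange (2 * graphCount 0 b + 2 * δ (graphCount 1) b) (δ (graphCount 0) b) (δ (δ (graphCount 2)) b) ⟩
  2 * graphCount 0 b + 2 * δ (graphCount 1) b + δ (δ (graphCount 2)) b + δ (graphCount 0) b ∎)
  where
  open ≡-Reasoning
  exchange : ∀ x y z → x + (y + z) ≡ x + z + y
  exchange = solve-∀

-- Involutions as graphs of maximal degree 1

∑-mono : ∀ (xs : List A) {φ ψ : A → ℕ} → (∀ x → φ x ≤ ψ x) → ∑ xs φ ≤ ∑ xs ψ
∑-mono []       φ≤ψ = z≤n
∑-mono (x ∷ xs) φ≤ψ = +-mono-≤ (φ≤ψ x) (∑-mono xs φ≤ψ)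

∑≤1⇒unique : ∀ (φ : Fin n → ℕ) → ∑ (allFin n) φ ≤ 1 → ∀ {x y} → φ x ≡ 1 → φ y ≡ 1 → x ≡ y
∑≤1⇒unique {n} φ ∑≤1 {x} {y} φx≡1 φy≡1 with x ≟ᶠ y
... | yes x≡y = x≡y
... | no x≢y = contradiction (begin
  2                ≡⟨ cong₂ _+_ φx≡1 φy≡1 ⟨
  φ x + φ y        ≡⟨ cong₂ _+_ (∑-select φ x) (∑-select φ y) ⟨
  ∑ (allFin n) (λ z → [ z ≟ᶠ x ] * φ z) + ∑ (allFin n) (λ z → [ z ≟ᶠ y ] * φ z)
                   ≡⟨ ∑-+ (allFin n) _ _ ⟨
  ∑ (allFin n) (λ z → [ z ≟ᶠ x ] * φ z + [ z ≟ᶠ y ] * φ z)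
                   ≤⟨ ∑-mono (allFin n) disjoint ⟩
  ∑ (allFin n) φ   ≤⟨ ∑≤1 ⟩
  1                ∎) (λ { (s≤s ()) })
  where
  open ≤-Reasoning
  open Enumeration (finEnumeration n) using (∑-select)
  disjoint : ∀ z → [ z ≟ᶠ x ] * φ z + [ z ≟ᶠ y ] * φ z ≤ φ z
  disjoint z with z ≟ᶠ x | z ≟ᶠ y
  ... | yes refl | yes refl = contradiction refl x≢y
  ... | yes _    | no _     = ≤-reflexive (trans (+-identityʳ _) (*-identityˡ (φ z)))
  ... | no _     | yes _    = ≤-reflexive (*-identityˡ (φ z))
  ... | no _     | no _     = z≤n

Edge : Vec (Fin n) n → Fin n → Fin n → Set
Edge π x y = lookup π x ≡ y × x ≢ y

edge? : ∀ (π : Vec (Fin n) n) x y → Dec (Edge π x y)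
edge? π x y = (lookup π x ≟ᶠ y) ×-dec ¬? (x ≟ᶠ y)

bit : {P : Set} → Dec P → Fin 3
bit (yes _) = one
bit (no _)  = zero

toℕ-bit : {P : Set} (P? : Dec P) → toℕ (bit P?) ≡ [ P? ]
toℕ-bit (yes _) = refl
toℕ-bit (no _)  = refl

[]≡1 : {P : Set} (P? : Dec P) → [ P? ] ≡ 1 → P
[]≡1 P? eq = []-≢0 P? λ ≡0 → contradiction (trans (sym eq) ≡0) λ ()

[]≤1 : {P : Set} (P? : Dec P) → [ P? ] ≤ 1
[]≤1 (yes _) = ≤-refl
[]≤1 (no _)  = z≤n

pairing : Vec (Fin n) n → Mult n
pairing π = tabulate λ x → tabulate λ y → bit (edge? π x y)

mult-tabulate : ∀ (e : Fin n → Fin n → Fin 3) x y → mult (tabulate λ x → tabulate (e x)) x y ≡ toℕ (e x y)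
mult-tabulate e x y = cong toℕ (trans (cong (λ row → lookup row y) (Vec.lookup∘tabulate (λ x → tabulate (e x)) x))
                                      (Vec.lookup∘tabulate (e x) y))

mult-pairing : ∀ (π : Vec (Fin n) n) x y → mult (pairing π) x y ≡ [ edge? π x y ]
mult-pairing π x y = trans (mult-tabulate (λ x y → bit (edge? π x y)) x y) (toℕ-bit (edge? π x y))

mult-ext : ∀ (M N : Mult n) → (∀ x y → mult M x y ≡ mult N x y) → M ≡ N
mult-ext M N eq = lookup-ext M N λ x → lookup-ext _ _ λ y → toℕ-injective (eq x y)
  where
  lookup-ext : ∀ {A : Set} {n} (xs ys : Vec A n) → lookup xs ≗ lookup ys → xs ≡ ys
  lookup-ext xs ys eq =
    trans (sym (Vec.tabulate∘lookup xs)) (trans (Vec.tabulate-cong eq) (Vec.tabulate∘lookup ys))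

neighbour? : ∀ (M : Mult n) x → Dec (∃ λ y → mult M x y ≡ 1)
neighbour? M x = any? λ y → mult M x y ≟ 1

-- The outcome of the search is an argument so that proofs can split on it. An isolated vertex
-- becomes a fixed point.
partner : (M : Mult n) (x : Fin n) → Dec (∃ λ y → mult M x y ≡ 1) → Fin n
partner M x (yes (y , _)) = y
partner M x (no _)        = x

partners : Mult n → Vec (Fin n) n
partners M = tabulate λ x → partner M x (neighbour? M x)

-- True for every map `π`: row x of its matrix can be nonzero only at `π x`, and it vanishes exactly
-- when x is fixed.
partners-pairing : ∀ (π : Vec (Fin n) n) → partners (pairing π) ≡ π
partners-pairing π = trans (Vec.tabulate-cong λ x → recover x (neighbour? (pairing π) x)) (Vec.tabulate∘lookup π)
  where
  recover : ∀ x nb → partner (pairing π) x nb ≡ lookup π x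
  recover x (yes (y , xy)) = sym (proj₁ ([]≡1 (edge? π x y) (trans (sym (mult-pairing π x y)) xy)))
  recover x (no isolated) with x ≟ᶠ lookup π x
  ... | yes x≡πx = x≡πx
  ... | no x≢πx = contradiction
    (_ , trans (mult-pairing π x (lookup π x)) ([]-yes (edge? π x (lookup π x)) (refl , x≢πx))) isolated

module _ (M : Mult n) (simple : Simple M) (fits : Fits (deg M) (replicate n one)) where

  deg≤1 : ∀ x → deg M x ≤ 1
  deg≤1 x = subst (λ c → deg M x ≤ toℕ c) (Vec.lookup-replicate x one) (fits x)

  -- Degree at most 1 makes the neighbour found by the search the only one.
  pairing-partners : pairing (partners M) ≡ M
  pairing-partners = mult-ext _ M λ x y → trans (mult-pairing (partners M) x y) (entry x y (neighbour? M x) (Vec.lookup∘tabulate _ x))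
    where
    loopless = proj₁ (proj₂ simple)
    single   = proj₂ (proj₂ simple)
    entry : ∀ x y nb → lookup (partners M) x ≡ partner M x nb → [ edge? (partners M) x y ] ≡ mult M x y
    entry x y nb eq with mult M x y in xy | single x y
    entry x y (yes (y' , xy')) eq | 0 | _ = []-no (edge? (partners M) x y)
      λ { (p , _) → contradiction (trans (sym xy') (trans (cong (mult M x) (trans (sym eq) p)) xy)) λ () }
    entry x y (no _) eq | 0 | _ = []-no (edge? (partners M) x y) λ { (p , x≢y) → x≢y (trans (sym eq) p) }
    entry x y (yes (y' , xy')) eq | 1 | _ = []-yes (edge? (partners M) x y)
      ( trans eq (∑≤1⇒unique (mult M x) (deg≤1 x) xy' xy)
      , λ { refl → contradiction (trans (sym xy) (loopless x)) λ () })
    entry x y (no isolated) eq | 1 | _ = contradiction (y , xy) isolated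
    entry x y nb eq | suc (suc _) | s≤s ()

-- Symmetry of the matrix is the involution law at the points that are not fixed, and that law
-- implies injectivity. The remaining graph conditions hold for the matrix of any map.
graph-pairing : ∀ (π : Vec (Fin n) n) → [ graph? (replicate n one) (pairing π) ] ≡ [ isInvolution? π ]
graph-pairing {n} π = []-⇔ (graph? (replicate n one) (pairing π)) (isInvolution? π) to from
  where
  to : Simple (pairing π) × Fits (deg (pairing π)) (replicate n one) → IsInvolution π
  to ((symm , _) , _) = (λ x y eq → trans (sym (inv x)) (trans (cong (lookup π) eq) (inv y))) , inv
    where
    inv : ∀ x → lookup π (lookup π x) ≡ x
    inv x with x ≟ᶠ lookup π x
    ... | yes x≡πx = trans (cong (lookup π) (sym x≡πx)) (sym x≡πx)
    ... | no x≢πx = proj₁ ([]≡1 (edge? π (lookup π x) x) (begin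
      [ edge? π (lookup π x) x ]          ≡⟨ mult-pairing π (lookup π x) x ⟨
      mult (pairing π) (lookup π x) x     ≡⟨ symm x (lookup π x) ⟨
      mult (pairing π) x (lookup π x)     ≡⟨ mult-pairing π x (lookup π x) ⟩
      [ edge? π x (lookup π x) ]          ≡⟨ []-yes (edge? π x (lookup π x)) (refl , x≢πx) ⟩
      1                                   ∎))
      where open ≡-Reasoning
  from : IsInvolution π → Simple (pairing π) × Fits (deg (pairing π)) (replicate n one)
  from (_ , inv) =
    ( (λ x y → trans (mult-pairing π x y) (trans ([]-⇔ (edge? π x y) (edge? π y x) (flip x y) (flip y x)) (sym (mult-pairing π y x))))
    , (λ x → trans (mult-pairing π x x) ([]-no (edge? π x x) λ { (_ , x≢x) → x≢x refl }))
    , (λ x y → subst (_≤ 1) (sym (mult-pairing π x y)) ([]≤1 (edge? π x y))) )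
    , λ x → subst (λ c → deg (pairing π) x ≤ toℕ c) (sym (Vec.lookup-replicate x one)) (pairing-deg≤1 x)
    where
    flip : ∀ x y → Edge π x y → Edge π y x
    flip x y (refl , x≢y) = inv x , x≢y ∘ sym
    pairing-deg≤1 : ∀ x → deg (pairing π) x ≤ 1
    pairing-deg≤1 x = begin
      ∑ (allFin n) (mult (pairing π) x)
        ≤⟨ ∑-mono (allFin n) (λ y → ≤-trans (≤-reflexive (mult-pairing π x y)) (bound y)) ⟩
      ∑ (allFin n) (λ y → [ y ≟ᶠ lookup π x ])
        ≡⟨ Enumeration.once (finEnumeration n) (lookup π x) ⟩
      1 ∎
      where
      open ≤-Reasoning
      bound : ∀ y → [ edge? π x y ] ≤ [ y ≟ᶠ lookup π x ]
      bound y with edge? π x y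
      ... | yes (refl , _) = ≤-reflexive (sym ([]-yes (y ≟ᶠ y) refl))
      ... | no _           = z≤n

ones-replicate : ∀ n → ones (replicate n one) ≡ n
ones-replicate zero    = refl
ones-replicate (suc n) = cong suc (ones-replicate n)

twos-replicate : ∀ n → twos (replicate n one) ≡ 0
twos-replicate zero    = refl
twos-replicate (suc n) = twos-replicate n

t≡graphCount : ∀ n → t n ≡ graphCount n 0
t≡graphCount n = begin
  t n
    ≡⟨ length-filter isInvolution? (allVecs (allFin n) n) ⟩
  ∑ (allVecs (allFin n) n) (λ π → [ isInvolution? π ])
    ≡⟨ ∑-cong (allVecs (allFin n) n) graph-pairing ⟨
  ∑ (allVecs (allFin n) n) (λ π → [ graph? (replicate n one) (pairing π) ])
    ≡⟨ ∑-reindex (multEnumeration n) (vecEnumeration (finEnumeration n) n) pairing partners partners-pairing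
         (λ M → [ graph? (replicate n one) M ])
         (λ M ≢0 → let simple , fits = []-≢0 (graph? (replicate n one) M) ≢0 in pairing-partners M simple fits) ⟨
  #graphs (replicate n one)
    ≡⟨ #graphs≡graphCount (replicate n one) ⟩
  onCounts graphCount (replicate n one)
    ≡⟨ cong₂ graphCount (ones-replicate n) (twos-replicate n) ⟩
  graphCount n 0 ∎
  where open ≡-Reasoning

-- The numbers `g` as graph counts

capacity : ∀ u ρ → Fin v → Fin 3
capacity u ρ x = if does (ρ ≟ 1) ∧ does (toℕ x ≟ u) then one else two

-- In `capacity` the quotient and remainder of m are independent arguments, which permits induction
-- on `u`: dropping the first vertex moves the special index down by one.
ones-capacity : ∀ u ρ → ρ < 2 → ones (tabulate (capacity {u + ρ} u ρ)) ≡ ρ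
ones-capacity u 0 _ = all-two u (u + 0)
  where
  all-two : ∀ w v → ones (tabulate (capacity {v} w 0)) ≡ 0
  all-two w zero    = refl
  all-two w (suc v) = all-two w v
ones-capacity zero    1 _   = refl
ones-capacity (suc u) 1 ρ<2 = ones-capacity u 1 ρ<2
ones-capacity u (suc (suc _)) (s≤s (s≤s ()))

twos-capacity : ∀ u ρ → ρ < 2 → twos (tabulate (capacity {u + ρ} u ρ)) ≡ u
twos-capacity u 0 _ = trans (all-two u (u + 0)) (+-identityʳ u)
  where
  all-two : ∀ w v → twos (tabulate (capacity {v} w 0)) ≡ v
  all-two w zero    = refl
  all-two w (suc v) = cong suc (all-two w v)
twos-capacity zero    1 _   = refl
twos-capacity (suc u) 1 ρ<2 = cong suc (twos-capacity u 1 ρ<2)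
twos-capacity u (suc (suc _)) (s≤s (s≤s ()))

g≡graphCount : ∀ m → g m ≡ graphCount (m % 2) (m / 2)
g≡graphCount m = begin
  g m
    ≡⟨ length-filter (counted? m) (allMult (numV m)) ⟩
  ∑ (allMult (numV m)) (λ M → [ counted? m M ])
    ≡⟨ ∑-cong (allMult (numV m)) (λ M → []-⇔ (counted? m M) (graph? caps M)
         (λ { ((symm , loopless , fits) , single) →
              (symm , loopless , single) , λ x → subst (deg M x ≤_) (sym (cap≡ x)) (fits x) })
         (λ { ((symm , loopless , single) , fits) →
              (symm , loopless , λ x → subst (deg M x ≤_) (cap≡ x) (fits x)) , single })) ⟩
  #graphs caps
    ≡⟨ #graphs≡graphCount caps ⟩
  onCounts graphCount caps
    ≡⟨ cong₂ graphCount (ones-capacity (m / 2) (m % 2) (m%n<n m 2)) (twos-capacity (m / 2) (m % 2) (m%n<n m 2)) ⟩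
  graphCount (m % 2) (m / 2) ∎
  where
  open ≡-Reasoning
  caps : Caps (numV m)
  caps = tabulate (capacity (m / 2) (m % 2))
  toℕ-if : ∀ b → toℕ {3} (if b then one else two) ≡ (if b then 1 else 2)
  toℕ-if true  = refl
  toℕ-if false = refl
  cap≡ : ∀ x → toℕ (lookup caps x) ≡ cap m x
  cap≡ x = trans (cong toℕ (Vec.lookup∘tabulate (capacity (m / 2) (m % 2)) x)) (toℕ-if _)

-- Adding double edges

δ-cong-< : ∀ {φ ψ : ℕ → ℕ} n → (∀ {m} → m < n → φ m ≡ ψ m) → δ φ n ≡ δ ψ n
δ-cong-< zero    eq = refl
δ-cong-< (suc n) eq = cong (suc n *_) (eq ≤-refl)

-- Ξ φ b = Σ_d m(b,d) 2^(b-d) φ(b-2d), where m(b,d) is the number of d-edge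
-- matchings on b points: on exponential generating functions, Φ(x) ↦ exp(x²) Φ(2x),
-- whose derivative gives the recursion.
Ξ : (ℕ → ℕ) → ℕ → ℕ
Ξ φ zero          = φ 0
Ξ φ (suc zero)    = 2 * φ 1
Ξ φ (suc (suc b)) = 2 * (suc b * Ξ φ b) + 2 * Ξ (φ ∘ suc) (suc b)

-- The derivative of exp(x²) Φ(2x) is 2x exp(x²) Φ(2x) + 2 exp(x²) Φ'(2x). The definition has the
-- `δ` unfolded, since a recursive call under `δ` would hide the decrease of the argument.
Ξ-suc : ∀ φ b → Ξ φ (suc b) ≡ 2 * δ (Ξ φ) b + 2 * Ξ (φ ∘ suc) b
Ξ-suc φ zero    = refl
Ξ-suc φ (suc b) = refl

Ξ-cong : ∀ {φ ψ : ℕ → ℕ} → φ ≗ ψ → Ξ φ ≗ Ξ ψ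
Ξ-cong φ≗ψ zero          = φ≗ψ 0
Ξ-cong φ≗ψ (suc zero)    = cong (2 *_) (φ≗ψ 1)
Ξ-cong φ≗ψ (suc (suc b)) =
  cong₂ (λ x y → 2 * (suc b * x) + 2 * y) (Ξ-cong φ≗ψ b) (Ξ-cong (φ≗ψ ∘ suc) (suc b))

Ξ-+ : ∀ φ ψ b → Ξ (λ n → φ n + ψ n) b ≡ Ξ φ b + Ξ ψ b
Ξ-+ φ ψ zero          = refl
Ξ-+ φ ψ (suc zero)    = *-distribˡ-+ 2 (φ 1) (ψ 1)
Ξ-+ φ ψ (suc (suc b)) = trans
  (cong₂ (λ x y → 2 * (suc b * x) + 2 * y) (Ξ-+ φ ψ b) (Ξ-+ (φ ∘ suc) (ψ ∘ suc) (suc b)))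
  (distribute (suc b) (Ξ φ b) (Ξ ψ b) (Ξ (φ ∘ suc) (suc b)) (Ξ (ψ ∘ suc) (suc b)))
  where
  distribute : ∀ s x y z w → 2 * (s * (x + y)) + 2 * (z + w) ≡ 2 * (s * x) + 2 * z + (2 * (s * y) + 2 * w)
  distribute = solve-∀

Ξ-*ˡ : ∀ c φ b → Ξ (λ n → c * φ n) b ≡ c * Ξ φ b
Ξ-*ˡ c φ zero          = refl
Ξ-*ˡ c φ (suc zero)    = commute c (φ 1)
  where
  commute : ∀ c x → 2 * (c * x) ≡ c * (2 * x)
  commute = solve-∀
Ξ-*ˡ c φ (suc (suc b)) = trans
  (cong₂ (λ x y → 2 * (suc b * x) + 2 * y) (Ξ-*ˡ c φ b) (Ξ-*ˡ c (φ ∘ suc) (suc b)))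
  (factor (suc b) c (Ξ φ b) (Ξ (φ ∘ suc) (suc b)))
  where
  factor : ∀ s c x y → 2 * (s * (c * x)) + 2 * (c * y) ≡ c * (2 * (s * x) + 2 * y)
  factor = solve-∀

-- For generating functions, xΦ(x) goes to exp(x²) · 2x · Φ(2x), that is, to 2x times the image of
-- Φ.
Ξ-δ : ∀ φ b → Ξ (δ φ) b ≡ 2 * δ (Ξ φ) b
Ξ-δ φ zero          = refl
Ξ-δ φ (suc zero)    = refl
Ξ-δ φ (suc (suc b)) = begin
  2 * (suc b * Ξ (δ φ) b) + 2 * Ξ (δ φ ∘ suc) (suc b)
    ≡⟨ cong₂ (λ x y → 2 * (suc b * x) + 2 * y) (Ξ-δ φ b) (Ξ-δφ-suc (Ξ-δ (φ ∘ suc) (suc b))) ⟩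
  2 * (suc b * (2 * δ (Ξ φ) b)) + 2 * (2 * (suc b * Ξ (φ ∘ suc) b) + Ξ φ (suc b))
    ≡⟨ regroup (suc b) (δ (Ξ φ) b) (Ξ (φ ∘ suc) b) (Ξ φ (suc b)) ⟩
  2 * (Ξ φ (suc b) + suc b * (2 * δ (Ξ φ) b + 2 * Ξ (φ ∘ suc) b))
    ≡⟨ cong (λ x → 2 * (Ξ φ (suc b) + suc b * x)) (Ξ-suc φ b) ⟨
  2 * (suc (suc b) * Ξ φ (suc b)) ∎
  where
  open ≡-Reasoning
  regroup : ∀ s x y z → 2 * (s * (2 * x)) + 2 * (2 * (s * y) + z) ≡ 2 * (z + s * (2 * x + 2 * y))
  regroup = solve-∀
  Ξ-δφ-suc : Ξ (δ (φ ∘ suc)) (suc b) ≡ 2 * δ (Ξ (φ ∘ suc)) (suc b) →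
             Ξ (δ φ ∘ suc) (suc b) ≡ 2 * (suc b * Ξ (φ ∘ suc) b) + Ξ φ (suc b)
  Ξ-δφ-suc ih = begin
    Ξ (δ φ ∘ suc) (suc b)                      ≡⟨ Ξ-cong (δ-suc φ) (suc b) ⟩
    Ξ (λ n → δ (φ ∘ suc) n + φ n) (suc b)      ≡⟨ Ξ-+ (δ (φ ∘ suc)) φ (suc b) ⟩
    Ξ (δ (φ ∘ suc)) (suc b) + Ξ φ (suc b)      ≡⟨ cong (_+ Ξ φ (suc b)) ih ⟩
    2 * (suc b * Ξ (φ ∘ suc) b) + Ξ φ (suc b)  ∎

-- The weighted sum depends only on a + 2b

module _ (f : ℕ → ℕ → ℕ)
         (f-rec₁ : ∀ a b → f (suc a) b ≡ f a b + D f a b)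
         (f-rec₂ : ∀ b → 2 * f 0 (suc b) ≡ 2 * f 0 b + 2 * δ (f 1) b + δ (δ (f 2)) b) where

  T : ℕ → ℕ → ℕ
  T a b = Ξ (f a) b

  -- `Ξ` acts on b, so it commutes with `δ` in a, while `δ` in b gains a factor 2. The result reads
  -- as for involutions: a single point is fixed, or matched with one of a single points or of 2b
  -- paired points.
  T-rec₁ : ∀ a b → T (suc a) b ≡ T a b + (δ (λ a' → T a' b) a + 2 * δ (T (suc a)) b)
  T-rec₁ a b = begin
    Ξ (f (suc a)) b
      ≡⟨ Ξ-cong (f-rec₁ a) b ⟩
    Ξ (λ b → f a b + D f a b) b
      ≡⟨ Ξ-+ (f a) (D f a) b ⟩
    Ξ (f a) b + Ξ (D f a) b
      ≡⟨ cong (T a b +_) (Ξ-+ (λ b → δ (λ a' → f a' b) a) (δ (f (suc a))) b) ⟩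
    Ξ (f a) b + (Ξ (λ b → δ (λ a' → f a' b) a) b + Ξ (δ (f (suc a))) b)
      ≡⟨ cong₂ (λ x y → T a b + (x + y)) (Ξ-δ₁ a) (Ξ-δ (f (suc a)) b) ⟩
    T a b + (δ (λ a' → T a' b) a + 2 * δ (T (suc a)) b) ∎
    where
    open ≡-Reasoning
    Ξ-δ₁ : ∀ a → Ξ (λ b → δ (λ a' → f a' b) a) b ≡ δ (λ a' → T a' b) a
    Ξ-δ₁ zero    = Ξ-*ˡ 0 (λ _ → 0) b
    Ξ-δ₁ (suc a) = Ξ-*ˡ (suc a) (f a) b

  -- The 2 in `Ξ-suc` is the one that `f-rec₂` asks for. The terms describe a new pair among b
  -- pairs: matched completely with one of them; both points fixed or swapped; one point matched
  -- outside and the other fixed; the points matched into two different pairs.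
  T-rec₂ : ∀ b → T 0 (suc b) ≡ 2 * δ (T 0) b + (2 * T 0 b + 4 * δ (T 1) b + 4 * δ (δ (T 2)) b)
  T-rec₂ b = trans (Ξ-suc (f 0) b) (cong (2 * δ (T 0) b +_) (begin
    2 * Ξ (f 0 ∘ suc) b
      ≡⟨ Ξ-*ˡ 2 (f 0 ∘ suc) b ⟨
    Ξ (λ b → 2 * f 0 (suc b)) b
      ≡⟨ Ξ-cong f-rec₂ b ⟩
    Ξ (λ b → 2 * f 0 b + 2 * δ (f 1) b + δ (δ (f 2)) b) b
      ≡⟨ Ξ-+ (λ b → 2 * f 0 b + 2 * δ (f 1) b) (δ (δ (f 2))) b ⟩
    Ξ (λ b → 2 * f 0 b + 2 * δ (f 1) b) b + Ξ (δ (δ (f 2))) b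
      ≡⟨ cong (_+ Ξ (δ (δ (f 2))) b) (Ξ-+ (λ b → 2 * f 0 b) (λ b → 2 * δ (f 1) b) b) ⟩
    Ξ (λ b → 2 * f 0 b) b + Ξ (λ b → 2 * δ (f 1) b) b + Ξ (δ (δ (f 2))) b
      ≡⟨ cong₂ _+_ (cong₂ _+_ (Ξ-*ˡ 2 (f 0) b)
           (trans (Ξ-*ˡ 2 (δ (f 1)) b) (trans (cong (2 *_) (Ξ-δ (f 1) b)) (sym (*-assoc 2 2 (δ (T 1) b))))))
           ΞδδT₂ ⟩
    2 * T 0 b + 4 * δ (T 1) b + 4 * δ (δ (T 2)) b ∎))
    where
    open ≡-Reasoning
    ΞδδT₂ : Ξ (δ (δ (f 2))) b ≡ 4 * δ (δ (T 2)) b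
    ΞδδT₂ = begin
      Ξ (δ (δ (f 2))) b              ≡⟨ Ξ-δ (δ (f 2)) b ⟩
      2 * δ (Ξ (δ (f 2))) b          ≡⟨ cong (2 *_) (δ-cong (Ξ-δ (f 2)) b) ⟩
      2 * δ (λ n → 2 * δ (T 2) n) b  ≡⟨ cong (2 *_) (δ-*ˡ 2 (δ (T 2)) b) ⟩
      2 * (2 * δ (δ (T 2)) b)        ≡⟨ *-assoc 2 2 (δ (δ (T 2)) b) ⟨
      4 * δ (δ (T 2)) b              ∎

  τ : ℕ → ℕ
  τ n = f n 0

  τ-suc : ∀ n → τ (suc n) ≡ τ n + δ τ n
  τ-suc n = trans (f-rec₁ n 0) (cong (τ n +_) (+-identityʳ (δ τ n)))

  δτ-shift : ∀ a m → δ τ (a + suc m) ≡ δ (λ a' → τ (a' + suc m)) a + suc m * τ (a + m)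
  δτ-shift zero    m = refl
  δτ-shift (suc a) m = trans (*-distribʳ-+ (τ (a + suc m)) (suc a) (suc m))
    (cong (λ i → suc a * τ (a + suc m) + suc m * τ i) (+-suc a m))

  -- This is `T-rec₂` with `τ (a + 2 * b)` in place of `T a b`. For positive b, repeated use of
  -- `τ-suc` reduces both sides to combinations of two consecutive values of `τ`.
  τ-even : ∀ b → 2 * δ (λ b → τ (2 * b)) b
                 + (2 * τ (2 * b) + 4 * δ (λ b → τ (1 + 2 * b)) b + 4 * δ (δ (λ b → τ (2 + 2 * b))) b)
               ≡ τ (2 * suc b)
  τ-even zero    = trans (identity (τ 0)) (sym (trans (τ-suc 1) (cong (_+ 1 * τ 0) (τ-suc 0))))
    where
    identity : ∀ x → 2 * 0 + (2 * x + 4 * 0 + 4 * 0) ≡ x + 0 + 1 * x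
    identity = solve-∀
  τ-even (suc b) = begin
    2 * (suc b * τ 2b) + (2 * τ (2 * suc b) + 4 * (suc b * τ (1 + 2b)) + 4 * (suc b * δ (λ b → τ (2 + 2 * b)) b))
      ≡⟨ cong₂ (λ m x → 2 * (suc b * τ 2b) + (2 * τ m + 4 * (suc b * τ (1 + 2b)) + 4 * (suc b * x)))
           (*-suc 2 b) (δτ-even b) ⟩
    2 * (suc b * τ 2b) + (2 * τ (2 + 2b) + 4 * (suc b * τ (1 + 2b)) + 4 * (suc b * (b * τ 2b)))
      ≡⟨ cong (λ z → 2 * (suc b * τ 2b) + (2 * z + 4 * (suc b * τ (1 + 2b)) + 4 * (suc b * (b * τ 2b)))) (τ-suc (1 + 2b)) ⟩
    2 * (suc b * τ 2b) + (2 * (τ (1 + 2b) + (1 + 2b) * τ 2b) + 4 * (suc b * τ (1 + 2b)) + 4 * (suc b * (b * τ 2b)))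
      ≡⟨ identity b (τ 2b) (τ (1 + 2b)) ⟩
    τ (1 + 2b) + (1 + 2b) * τ 2b + (2 + 2b) * τ (1 + 2b) + (3 + 2b) * (τ (1 + 2b) + (1 + 2b) * τ 2b)
      ≡⟨ cong (λ z → z + (2 + 2b) * τ (1 + 2b) + (3 + 2b) * z) (τ-suc (1 + 2b)) ⟨
    τ (2 + 2b) + (2 + 2b) * τ (1 + 2b) + (3 + 2b) * τ (2 + 2b)
      ≡⟨ cong (_+ (3 + 2b) * τ (2 + 2b)) (τ-suc (2 + 2b)) ⟨
    τ (3 + 2b) + (3 + 2b) * τ (2 + 2b)
      ≡⟨ τ-suc (3 + 2b) ⟨
    τ (4 + 2b)
      ≡⟨ cong τ (trans (*-suc 2 (suc b)) (cong (2 +_) (*-suc 2 b))) ⟨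
    τ (2 * suc (suc b)) ∎
    where
    open ≡-Reasoning
    2b = 2 * b
    δτ-even : ∀ b → δ (λ b → τ (2 + 2 * b)) b ≡ b * τ (2 * b)
    δτ-even zero    = refl
    δτ-even (suc b) = cong (λ m → suc b * τ m) (sym (*-suc 2 b))
    identity : ∀ b x y →
      2 * ((1 + b) * x) + (2 * (y + (1 + 2 * b) * x) + 4 * ((1 + b) * y) + 4 * ((1 + b) * (b * x)))
        ≡ y + (1 + 2 * b) * x + (2 + 2 * b) * y + (3 + 2 * b) * (y + (1 + 2 * b) * x)
    identity = solve-∀

  -- Lexicographic induction with b first: the recurrences lower a at the same b, or lower b while a
  -- may grow, so for smaller b the claim must be available for all a. For b = 0 it holds because
  -- `Ξ φ 0` is `φ 0`.
  T≡τ : ∀ b a → T a b ≡ τ (a + 2 * b)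
  T≡τ = <-rec _ outer
    where
    open ≡-Reasoning
    outer : ∀ b → (∀ {b'} → b' < b → ∀ a → T a b' ≡ τ (a + 2 * b')) → ∀ a → T a b ≡ τ (a + 2 * b)
    outer zero    _   a = cong τ (sym (+-identityʳ a))
    outer (suc b) smaller = <-rec _ inner
      where
      δT : ∀ a {n} → n < suc (suc b) → δ (T a) n ≡ δ (λ b → τ (a + 2 * b)) n
      δT a {n} (s≤s n≤b) = δ-cong-< n λ m<n → smaller (≤-trans m<n n≤b) a
      inner : ∀ a → (∀ {a'} → a' < a → T a' (suc b) ≡ τ (a' + 2 * suc b)) → T a (suc b) ≡ τ (a + 2 * suc b)
      inner zero _ = begin
        T 0 (suc b)
          ≡⟨ T-rec₂ b ⟩
        2 * δ (T 0) b + (2 * T 0 b + 4 * δ (T 1) b + 4 * δ (δ (T 2)) b)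
          ≡⟨ cong₂ _+_ (cong (2 *_) (δT 0 b<))
               (cong₂ _+_ (cong₂ _+_ (cong (2 *_) (smaller ≤-refl 0)) (cong (4 *_) (δT 1 b<)))
                          (cong (4 *_) (δ-cong-< b λ m<b → δT 2 (<-trans m<b b<)))) ⟩
        2 * δ (λ b → τ (2 * b)) b
          + (2 * τ (2 * b) + 4 * δ (λ b → τ (1 + 2 * b)) b + 4 * δ (δ (λ b → τ (2 + 2 * b))) b)
          ≡⟨ τ-even b ⟩
        τ (2 * suc b) ∎
        where
        b< : b < suc (suc b)
        b< = m<n⇒m<1+n ≤-refl
      inner (suc a) smaller-a = begin
        T (suc a) (suc b)
          ≡⟨ T-rec₁ a (suc b) ⟩
        T a (suc b) + (δ (λ a' → T a' (suc b)) a + 2 * (suc b * T (suc a) b))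
          ≡⟨ cong₂ _+_ (smaller-a ≤-refl)
               (cong₂ _+_ (δ-cong-< a λ m<a → smaller-a (m<n⇒m<1+n m<a))
                          (cong (λ x → 2 * (suc b * x)) (smaller ≤-refl (suc a)))) ⟩
        τ (a + 2 * suc b) + (δ (λ a' → τ (a' + 2 * suc b)) a + 2 * (suc b * τ (suc a + 2 * b)))
          ≡⟨ cong (λ x → τ (a + 2 * suc b) + (δ (λ a' → τ (a' + 2 * suc b)) a + x)) half ⟩
        τ (a + 2 * suc b) + (δ (λ a' → τ (a' + 2 * suc b)) a + 2 * suc b * τ (a + (b + suc (b + 0))))
          ≡⟨ cong (τ (a + 2 * suc b) +_) (δτ-shift a (b + suc (b + 0))) ⟨
        τ (a + 2 * suc b) + δ τ (a + 2 * suc b)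
          ≡⟨ τ-suc (a + 2 * suc b) ⟨
        τ (suc a + 2 * suc b) ∎
        where
        -- `2 * suc b` reduces to `suc (b + suc (b + 0))`; its predecessor is the `m` with which
        -- `δτ-shift` is applied.
        half : 2 * (suc b * τ (suc a + 2 * b)) ≡ 2 * suc b * τ (a + (b + suc (b + 0)))
        half = trans (sym (*-assoc 2 (suc b) _))
          (cong (λ m → 2 * suc b * τ m) (sym (trans (cong (a +_) (+-suc b (b + 0))) (+-suc a (2 * b)))))

-- The coefficients

Σ-first : ∀ k φ → Σ[0to suc k ] φ ≡ φ 0 + Σ[0to k ] (φ ∘ suc)
Σ-first k φ = cong (λ l → φ 0 + sum l)
  (trans (map-applyUpTo suc φ (suc k)) (sym (map-upTo (φ ∘ suc) (suc k))))

Σ-last : ∀ k φ → Σ[0to suc k ] φ ≡ Σ[0to k ] φ + φ (suc k)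
Σ-last k φ = begin
  ∑ (upTo (suc (suc k))) φ          ≡⟨ cong (λ l → ∑ l φ) (upTo-∷ʳ (suc k)) ⟨
  ∑ (upTo (suc k) ∷ʳ suc k) φ       ≡⟨ ∑-++ (upTo (suc k)) (suc k ∷ []) φ ⟩
  Σ[0to k ] φ + (φ (suc k) + 0)     ≡⟨ cong (Σ[0to k ] φ +_) (+-identityʳ (φ (suc k))) ⟩
  Σ[0to k ] φ + φ (suc k)           ∎
  where open ≡-Reasoning

Σ-cong-≤ : ∀ k {φ ψ : ℕ → ℕ} → (∀ {i} → i ≤ k → φ i ≡ ψ i) → Σ[0to k ] φ ≡ Σ[0to k ] ψ
Σ-cong-≤ zero    eq = cong (_+ 0) (eq z≤n)
Σ-cong-≤ (suc k) {φ} {ψ} eq = begin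
  Σ[0to suc k ] φ          ≡⟨ Σ-last k φ ⟩
  Σ[0to k ] φ + φ (suc k)  ≡⟨ cong₂ _+_ (Σ-cong-≤ k (λ i≤k → eq (m≤n⇒m≤1+n i≤k))) (eq ≤-refl) ⟩
  Σ[0to k ] ψ + ψ (suc k)  ≡⟨ Σ-last k ψ ⟨
  Σ[0to suc k ] ψ          ∎
  where open ≡-Reasoning

Σ-+ : ∀ k φ ψ → Σ[0to k ] (λ i → φ i + ψ i) ≡ Σ[0to k ] φ + Σ[0to k ] ψ
Σ-+ k = ∑-+ (upTo (suc k))

Σ-*ˡ : ∀ k c φ → Σ[0to k ] (λ i → c * φ i) ≡ c * Σ[0to k ] φ
Σ-*ˡ k = ∑-*ˡ (upTo (suc k))

Σ-extend : ∀ k φ → φ (suc k) ≡ 0 → Σ[0to suc k ] φ ≡ Σ[0to k ] φ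
Σ-extend k φ ≡0 = trans (Σ-last k φ) (trans (cong (Σ[0to k ] φ +_) ≡0) (+-identityʳ _))

C-absorb : ∀ n k → suc k * (suc n C suc k) ≡ suc n * (n C k)
C-absorb zero    zero    = refl
C-absorb zero    (suc k) = trans (cong (suc (suc k) *_) (k>n⇒nCk≡0 {1} {suc (suc k)} (s≤s (s≤s z≤n))))
  (trans (*-zeroʳ (suc (suc k))) (sym (cong (1 *_) (k>n⇒nCk≡0 {0} {suc k} (s≤s z≤n)))))
C-absorb (suc n) zero    = begin
  1 * (suc (suc n) C 1)                 ≡⟨ cong (1 *_) (nCk+nC[k+1]≡[n+1]C[k+1] (suc n) 0) ⟨
  1 * (1 + (suc n C 1))                 ≡⟨ *-distribˡ-+ 1 1 (suc n C 1) ⟩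
  1 + 1 * (suc n C 1)                   ≡⟨ cong (1 +_) (C-absorb n 0) ⟩
  1 + suc n * 1                         ∎
  where open ≡-Reasoning
C-absorb (suc n) (suc k) = begin
  suc (suc k) * (suc (suc n) C suc (suc k))
    ≡⟨ cong (suc (suc k) *_) (nCk+nC[k+1]≡[n+1]C[k+1] (suc n) (suc k)) ⟨
  suc (suc k) * (c + (suc n C suc (suc k)))
    ≡⟨ split (suc k) c (suc n C suc (suc k)) ⟩
  c + (suc k * c + suc (suc k) * (suc n C suc (suc k)))
    ≡⟨ cong (c +_) (cong₂ _+_ (C-absorb n k) (C-absorb n (suc k))) ⟩
  c + (suc n * (n C k) + suc n * (n C suc k))
    ≡⟨ cong (c +_) (*-distribˡ-+ (suc n) (n C k) (n C suc k)) ⟨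
  c + suc n * ((n C k) + (n C suc k))
    ≡⟨ cong (λ x → c + suc n * x) (nCk+nC[k+1]≡[n+1]C[k+1] n k) ⟩
  suc (suc n) * c ∎
  where
  open ≡-Reasoning
  c = suc n C suc k
  split : ∀ s x y → (1 + s) * (x + y) ≡ x + (s * x + (1 + s) * y)
  split = solve-∀

-- The identity (n+1-k) C(n+1,k) = (n+1) C(n,k) with the subtraction moved across.
C-step : ∀ n k → suc n * (suc n C k) ≡ suc n * (n C k) + k * (suc n C k)
C-step n zero    = sym (+-identityʳ _)
C-step n (suc k) = begin
  suc n * (suc n C suc k)                          ≡⟨ cong (suc n *_) (nCk+nC[k+1]≡[n+1]C[k+1] n k) ⟨
  suc n * ((n C k) + (n C suc k))                  ≡⟨ *-distribˡ-+ (suc n) (n C k) (n C suc k) ⟩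
  suc n * (n C k) + suc n * (n C suc k)            ≡⟨ +-comm (suc n * (n C k)) _ ⟩
  suc n * (n C suc k) + suc n * (n C k)            ≡⟨ cong (suc n * (n C suc k) +_) (C-absorb n k) ⟨
  suc n * (n C suc k) + suc k * (suc n C suc k)    ∎
  where open ≡-Reasoning

poch-∣ : ∀ {I K} → I ≤ K → poch 1 2 I ∣ poch 1 2 K
poch-∣ {I} {K} I≤K with m≤n⇒m<n∨m≡n I≤K
poch-∣ {I} {suc K} I≤K | inj₁ (s≤s I≤K′) = ∣m⇒∣m*n (1 + K * 2) (poch-∣ I≤K′)
poch-∣ I≤K | inj₂ refl = ∣-refl

Quot*poch : ∀ {I K} → I ≤ K → poch12Quot K I * poch 1 2 I ≡ poch 1 2 K
Quot*poch {I} {K} I≤K = m/n*n≡m {poch 1 2 K} {poch 1 2 I} {{poch12-nonZero I}} (poch-∣ I≤K)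

Quot-sucˡ : ∀ {I K} → I ≤ K → poch12Quot (suc K) I ≡ (1 + 2 * K) * poch12Quot K I
Quot-sucˡ {I} {K} I≤K = *-cancelʳ-≡ _ _ (poch 1 2 I) {{poch12-nonZero I}} (begin
  poch12Quot (suc K) I * poch 1 2 I              ≡⟨ Quot*poch (m≤n⇒m≤1+n I≤K) ⟩
  poch 1 2 K * (1 + K * 2)                       ≡⟨ cong (_* (1 + K * 2)) (Quot*poch I≤K) ⟨
  poch12Quot K I * poch 1 2 I * (1 + K * 2)      ≡⟨ commute (poch12Quot K I) (poch 1 2 I) K ⟩
  (1 + 2 * K) * poch12Quot K I * poch 1 2 I      ∎)
  where
  open ≡-Reasoning
  commute : ∀ q p k → q * p * (1 + k * 2) ≡ (1 + 2 * k) * q * p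
  commute = solve-∀

Quot-sucʳ : ∀ {I K} → I < K → poch12Quot K I ≡ (1 + 2 * I) * poch12Quot K (suc I)
Quot-sucʳ {I} {K} I<K = *-cancelʳ-≡ _ _ (poch 1 2 I) {{poch12-nonZero I}} (begin
  poch12Quot K I * poch 1 2 I                        ≡⟨ Quot*poch (<⇒≤ I<K) ⟩
  poch 1 2 K                                         ≡⟨ Quot*poch I<K ⟨
  poch12Quot K (suc I) * (poch 1 2 I * (1 + I * 2))  ≡⟨ commute (poch12Quot K (suc I)) (poch 1 2 I) I ⟩
  (1 + 2 * I) * poch12Quot K (suc I) * poch 1 2 I    ∎)
  where
  open ≡-Reasoning
  commute : ∀ q p i → q * (p * (1 + i * 2)) ≡ (1 + 2 * i) * q * p
  commute = solve-∀

Quot-refl : ∀ K → poch12Quot K K ≡ 1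
Quot-refl K = *-cancelʳ-≡ _ _ (poch 1 2 K) {{poch12-nonZero K}} (trans (Quot*poch {K} ≤-refl) (sym (*-identityˡ (poch 1 2 K))))

-- For i ≤ k these are 2^i times the number of matchings with k-i edges on 2k and on 2k+1 points.
-- The 2^(b-d) of `Ξ` is then 2^i times 2^k or 2^(k+1), and the second power is taken out of the
-- sum.
evenCoeff oddCoeff : ℕ → ℕ → ℕ
evenCoeff k i = 2 ^ i * (k C i) * poch12Quot k i
oddCoeff  k i = 2 ^ i * (k C i) * poch12Quot (suc k) (suc i)

-- Sums are extended by the index `suc k`, where `poch12Quot` need not be an exact quotient; the
-- binomial coefficient removes that term.
C-vanish : ∀ k i q → 2 ^ i * (k C suc k) * q ≡ 0
C-vanish k i q = cong (_* q) (trans (cong (2 ^ i *_) (k>n⇒nCk≡0 {k} {suc k} ≤-refl)) (*-zeroʳ (2 ^ i)))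

evenCoeff-suc-0 : ∀ k → evenCoeff (suc k) 0 ≡ (1 + 2 * k) * evenCoeff k 0
evenCoeff-suc-0 k = trans (cong (1 * 1 *_) (Quot-sucˡ {0} {k} z≤n)) (unit (1 + 2 * k) (poch12Quot k 0))
  where
  unit : ∀ x y → 1 * 1 * (x * y) ≡ x * (1 * 1 * y)
  unit = solve-∀

-- For matchings on 2k+2 points: the last point is matched with one of 2k+1 others or left free. In
-- the closed form this is Pascal's rule.
evenCoeff-suc-suc : ∀ {k i} → i ≤ k → evenCoeff (suc k) (suc i) ≡ (1 + 2 * k) * evenCoeff k (suc i) + 2 * oddCoeff k i
evenCoeff-suc-suc {k} {i} i≤k = begin
  2 * 2 ^ i * (suc k C suc i) * q
    ≡⟨ cong (λ c → 2 * 2 ^ i * c * q) (nCk+nC[k+1]≡[n+1]C[k+1] k i) ⟨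
  2 * 2 ^ i * ((k C i) + (k C suc i)) * q
    ≡⟨ split (2 ^ i) (k C i) (k C suc i) q ⟩
  2 * 2 ^ i * (k C suc i) * q + 2 * oddCoeff k i
    ≡⟨ cong (_+ 2 * oddCoeff k i) lower ⟩
  (1 + 2 * k) * evenCoeff k (suc i) + 2 * oddCoeff k i ∎
  where
  open ≡-Reasoning
  q = poch12Quot (suc k) (suc i)
  split : ∀ p x y q → 2 * p * (x + y) * q ≡ 2 * p * y * q + 2 * (p * x * q)
  split = solve-∀
  factor : ∀ p c m q → p * c * (m * q) ≡ m * (p * c * q)
  factor = solve-∀
  lower : 2 * 2 ^ i * (k C suc i) * q ≡ (1 + 2 * k) * evenCoeff k (suc i)
  lower with m≤n⇒m<n∨m≡n i≤k
  ... | inj₁ i<k  = trans (cong (2 * 2 ^ i * (k C suc i) *_) (Quot-sucˡ i<k))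
                          (factor (2 * 2 ^ i) (k C suc i) (1 + 2 * k) (poch12Quot k (suc i)))
  -- At i = k the step for quotients would need `suc k ≤ k`, but both sides are 0.
  ... | inj₂ refl = trans (C-vanish k (suc k) q)
                          (sym (trans (cong ((1 + 2 * k) *_) (C-vanish k (suc k) (poch12Quot k (suc k)))) (*-zeroʳ (1 + 2 * k))))

-- The same alternative for the last of 2k+3 points, which has 2k+2 possible partners. Here `C-step`
-- takes the place of Pascal's rule: its term with factor i turns 1 into 1 + 2i, the ratio between
-- neighbouring quotients.
oddCoeff-suc : ∀ {k i} → i ≤ suc k → oddCoeff (suc k) i ≡ 2 * suc k * oddCoeff k i + evenCoeff (suc k) i
oddCoeff-suc {k} {i} i≤1+k with m≤n⇒m<n∨m≡n i≤1+k
... | inj₁ (s≤s i≤k) = begin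
  2 ^ i * (suc k C i) * poch12Quot (suc (suc k)) (suc i)
    ≡⟨ cong (2 ^ i * (suc k C i) *_) (Quot-sucˡ (s≤s i≤k)) ⟩
  2 ^ i * (suc k C i) * ((1 + 2 * suc k) * q)
    ≡⟨ gather (2 ^ i) (suc k C i) (suc k) q ⟩
  2 ^ i * ((suc k C i) + 2 * (suc k * (suc k C i))) * q
    ≡⟨ cong (λ c → 2 ^ i * ((suc k C i) + 2 * c) * q) (C-step k i) ⟩
  2 ^ i * ((suc k C i) + 2 * (suc k * (k C i) + i * (suc k C i))) * q
    ≡⟨ split (2 ^ i) (suc k C i) (suc k) (k C i) i q ⟩
  2 * suc k * oddCoeff k i + 2 ^ i * (suc k C i) * ((1 + 2 * i) * q)
    ≡⟨ cong (λ x → 2 * suc k * oddCoeff k i + 2 ^ i * (suc k C i) * x) (Quot-sucʳ (s≤s i≤k)) ⟨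
  2 * suc k * oddCoeff k i + evenCoeff (suc k) i ∎
  where
  open ≡-Reasoning
  q = poch12Quot (suc k) (suc i)
  gather : ∀ p c s q → p * c * ((1 + 2 * s) * q) ≡ p * (c + 2 * (s * c)) * q
  gather = solve-∀
  split : ∀ p c s d i q → p * (c + 2 * (s * d + i * c)) * q ≡ 2 * s * (p * d * q) + p * c * ((1 + 2 * i) * q)
  split = solve-∀
-- At i = k+1 there are no edges left to place: the first summand vanishes and both quotients are 1.
... | inj₂ refl = begin
  2 ^ suc k * (suc k C suc k) * poch12Quot (suc (suc k)) (suc (suc k))
    ≡⟨ cong (2 ^ suc k * (suc k C suc k) *_) (trans (Quot-refl (suc (suc k))) (sym (Quot-refl (suc k)))) ⟩
  evenCoeff (suc k) (suc k)
    ≡⟨ cong (_+ evenCoeff (suc k) (suc k))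
         (trans (cong (2 * suc k *_) (C-vanish k (suc k) (poch12Quot (suc k) (suc (suc k))))) (*-zeroʳ (2 * suc k))) ⟨
  2 * suc k * oddCoeff k (suc k) + evenCoeff (suc k) (suc k) ∎
  where open ≡-Reasoning

Σ-evenCoeff-suc : ∀ k (φ : ℕ → ℕ) → Σ[0to suc k ] (λ i → evenCoeff (suc k) i * φ (2 * i))
                     ≡ (1 + 2 * k) * Σ[0to k ] (λ i → evenCoeff k i * φ (2 * i))
                       + 2 * Σ[0to k ] (λ i → oddCoeff k i * φ (suc (suc (2 * i))))
Σ-evenCoeff-suc k φ = begin
  Σ[0to suc k ] (λ i → evenCoeff (suc k) i * φ (2 * i))
    ≡⟨ Σ-first k (λ i → evenCoeff (suc k) i * φ (2 * i)) ⟩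
  evenCoeff (suc k) 0 * φ 0 + Σ[0to k ] (λ i → evenCoeff (suc k) (suc i) * φ (2 * suc i))
    ≡⟨ cong₂ _+_ (trans (cong (_* φ 0) (evenCoeff-suc-0 k)) (*-assoc m (evenCoeff k 0) (φ 0)))
         (trans (Σ-cong-≤ k term) (trans (Σ-+ k (λ i → m * (evenCoeff k (suc i) * φ (2 * suc i))) (λ i → 2 * (oddCoeff k i * φ (suc (suc (2 * i))))))
           (cong₂ _+_ (Σ-*ˡ k m (λ i → evenCoeff k (suc i) * φ (2 * suc i))) (Σ-*ˡ k 2 (λ i → oddCoeff k i * φ (suc (suc (2 * i))))))))  ⟩
  m * (evenCoeff k 0 * φ 0) + (m * Σ[0to k ] (λ i → evenCoeff k (suc i) * φ (2 * suc i)) + 2 * odds)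
    ≡⟨ regroup m (evenCoeff k 0 * φ 0) (Σ[0to k ] (λ i → evenCoeff k (suc i) * φ (2 * suc i))) (2 * odds) ⟩
  m * (evenCoeff k 0 * φ 0 + Σ[0to k ] (λ i → evenCoeff k (suc i) * φ (2 * suc i))) + 2 * odds
    ≡⟨ cong (λ x → m * x + 2 * odds) (trans (sym (Σ-first k (λ i → evenCoeff k i * φ (2 * i))))
         (Σ-extend k (λ i → evenCoeff k i * φ (2 * i)) (cong (_* φ (2 * suc k)) (C-vanish k (suc k) (poch12Quot k (suc k)))))) ⟩
  m * Σ[0to k ] (λ i → evenCoeff k i * φ (2 * i)) + 2 * odds ∎
  where
  open ≡-Reasoning
  m = 1 + 2 * k
  odds = Σ[0to k ] (λ i → oddCoeff k i * φ (suc (suc (2 * i))))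
  regroup : ∀ m x y z → m * x + (m * y + z) ≡ m * (x + y) + z
  regroup = solve-∀
  distribute : ∀ m x y z → (m * x + 2 * y) * z ≡ m * (x * z) + 2 * (y * z)
  distribute = solve-∀
  term : ∀ {i} → i ≤ k → evenCoeff (suc k) (suc i) * φ (2 * suc i)
                         ≡ m * (evenCoeff k (suc i) * φ (2 * suc i)) + 2 * (oddCoeff k i * φ (suc (suc (2 * i))))
  term {i} i≤k = begin
    evenCoeff (suc k) (suc i) * φ (2 * suc i)
      ≡⟨ cong (_* φ (2 * suc i)) (evenCoeff-suc-suc i≤k) ⟩
    (m * evenCoeff k (suc i) + 2 * oddCoeff k i) * φ (2 * suc i)
      ≡⟨ distribute m (evenCoeff k (suc i)) (oddCoeff k i) (φ (2 * suc i)) ⟩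
    m * (evenCoeff k (suc i) * φ (2 * suc i)) + 2 * (oddCoeff k i * φ (2 * suc i))
      ≡⟨ cong (λ j → m * (evenCoeff k (suc i) * φ (2 * suc i)) + 2 * (oddCoeff k i * φ j)) (*-suc 2 i) ⟩
    m * (evenCoeff k (suc i) * φ (2 * suc i)) + 2 * (oddCoeff k i * φ (suc (suc (2 * i)))) ∎

Σ-oddCoeff-suc : ∀ k (φ : ℕ → ℕ) → Σ[0to suc k ] (λ i → oddCoeff (suc k) i * φ i)
                    ≡ 2 * suc k * Σ[0to k ] (λ i → oddCoeff k i * φ i) + Σ[0to suc k ] (λ i → evenCoeff (suc k) i * φ i)
Σ-oddCoeff-suc k φ = begin
  Σ[0to suc k ] (λ i → oddCoeff (suc k) i * φ i)
    ≡⟨ Σ-cong-≤ (suc k) (λ {i} i≤ → trans (cong (_* φ i) (oddCoeff-suc i≤)) (distribute (2 * suc k) (oddCoeff k i) (evenCoeff (suc k) i) (φ i))) ⟩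
  Σ[0to suc k ] (λ i → 2 * suc k * (oddCoeff k i * φ i) + evenCoeff (suc k) i * φ i)
    ≡⟨ Σ-+ (suc k) (λ i → 2 * suc k * (oddCoeff k i * φ i)) (λ i → evenCoeff (suc k) i * φ i) ⟩
  Σ[0to suc k ] (λ i → 2 * suc k * (oddCoeff k i * φ i)) + Σ[0to suc k ] (λ i → evenCoeff (suc k) i * φ i)
    ≡⟨ cong (_+ Σ[0to suc k ] (λ i → evenCoeff (suc k) i * φ i))
         (trans (Σ-*ˡ (suc k) (2 * suc k) (λ i → oddCoeff k i * φ i)) (cong (2 * suc k *_)
           (Σ-extend k (λ i → oddCoeff k i * φ i) (cong (_* φ (suc k)) (C-vanish k (suc k) (poch12Quot (suc k) (suc (suc k)))))))) ⟩
  2 * suc k * Σ[0to k ] (λ i → oddCoeff k i * φ i) + Σ[0to suc k ] (λ i → evenCoeff (suc k) i * φ i) ∎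
  where
  open ≡-Reasoning
  distribute : ∀ m x y z → (m * x + y) * z ≡ m * (x * z) + y * z
  distribute = solve-∀

-- The two parities are proved together, because one step of `Ξ` shifts `φ` and lowers the index by
-- one. The odd case at `suc k` uses the even case at the same `suc k`.
Ξ-even : ∀ k φ → Ξ φ (2 * k) ≡ 2 ^ k * Σ[0to k ] (λ i → evenCoeff k i * φ (2 * i))
Ξ-odd  : ∀ k φ → Ξ φ (suc (2 * k)) ≡ 2 ^ suc k * Σ[0to k ] (λ i → oddCoeff k i * φ (suc (2 * i)))

Ξ-even zero    φ = identity (φ 0)
  where
  identity : ∀ x → x ≡ 1 * (1 * 1 * 1 * x + 0)
  identity = solve-∀
Ξ-even (suc k) φ = begin
  Ξ φ (2 * suc k)
    ≡⟨ cong (Ξ φ) (*-suc 2 k) ⟩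
  2 * (suc (2 * k) * Ξ φ (2 * k)) + 2 * Ξ (φ ∘ suc) (suc (2 * k))
    ≡⟨ cong₂ (λ x y → 2 * (suc (2 * k) * x) + 2 * y) (Ξ-even k φ) (Ξ-odd k (φ ∘ suc)) ⟩
  2 * (suc (2 * k) * (2 ^ k * evens)) + 2 * (2 * 2 ^ k * odds)
    ≡⟨ regroup (1 + 2 * k) (2 ^ k) evens odds ⟩
  2 * 2 ^ k * ((1 + 2 * k) * evens + 2 * odds)
    ≡⟨ cong (2 * 2 ^ k *_) (Σ-evenCoeff-suc k φ) ⟨
  2 ^ suc k * Σ[0to suc k ] (λ i → evenCoeff (suc k) i * φ (2 * i)) ∎
  where
  open ≡-Reasoning
  evens = Σ[0to k ] (λ i → evenCoeff k i * φ (2 * i))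
  odds = Σ[0to k ] (λ i → oddCoeff k i * φ (suc (suc (2 * i))))
  regroup : ∀ m p x y → 2 * (m * (p * x)) + 2 * (2 * p * y) ≡ 2 * p * (m * x + 2 * y)
  regroup = solve-∀

Ξ-odd zero    φ = identity (φ 1)
  where
  identity : ∀ x → 2 * x ≡ 2 * 1 * (1 * 1 * 1 * x + 0)
  identity = solve-∀
Ξ-odd (suc k) φ = begin
  Ξ φ (suc (2 * suc k))
    ≡⟨ Ξ-suc φ (2 * suc k) ⟩
  2 * δ (Ξ φ) (2 * suc k) + 2 * Ξ (φ ∘ suc) (2 * suc k)
    ≡⟨ cong₂ (λ x y → 2 * x + 2 * y) (trans (cong (δ (Ξ φ)) (*-suc 2 k)) (cong (suc (suc (2 * k)) *_) (Ξ-odd k φ)))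
                                     (Ξ-even (suc k) (φ ∘ suc)) ⟩
  2 * (suc (suc (2 * k)) * (2 ^ suc k * odds)) + 2 * (2 ^ suc k * evens)
    ≡⟨ regroup k (2 ^ suc k) odds evens ⟩
  2 * 2 ^ suc k * (2 * suc k * odds + evens)
    ≡⟨ cong (2 * 2 ^ suc k *_) (Σ-oddCoeff-suc k (λ i → φ (suc (2 * i)))) ⟨
  2 ^ suc (suc k) * Σ[0to suc k ] (λ i → oddCoeff (suc k) i * φ (suc (2 * i))) ∎
  where
  open ≡-Reasoning
  odds = Σ[0to k ] (λ i → oddCoeff k i * φ (suc (2 * i)))
  evens = Σ[0to suc k ] (λ i → evenCoeff (suc k) i * φ (suc (2 * i)))
  regroup : ∀ k p x y → 2 * ((2 + 2 * k) * (p * x)) + 2 * (p * y) ≡ 2 * p * (2 * (1 + k) * x + y)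
  regroup = solve-∀

Ξ-closed : ∀ h k φ → h < 2 →
  Ξ φ (2 * k + h) ≡ 2 ^ (k + h) * Σ[0to k ] (λ i → 2 ^ i * (k C i) * poch12Quot (k + h) (i + h) * φ (2 * i + h))
Ξ-closed 0 k φ _ = begin
  Ξ φ (2 * k + 0)  ≡⟨ cong (Ξ φ) (+-identityʳ (2 * k)) ⟩
  Ξ φ (2 * k)      ≡⟨ Ξ-even k φ ⟩
  2 ^ k * Σ[0to k ] (λ i → evenCoeff k i * φ (2 * i))
    ≡⟨ cong₂ (λ m s → 2 ^ m * s) (sym (+-identityʳ k)) (∑-cong (upTo (suc k)) λ i →
         cong₂ _*_ (cong (2 ^ i * (k C i) *_) (cong₂ poch12Quot (sym (+-identityʳ k)) (sym (+-identityʳ i))))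
                   (cong φ (sym (+-identityʳ (2 * i))))) ⟩
  2 ^ (k + 0) * Σ[0to k ] (λ i → 2 ^ i * (k C i) * poch12Quot (k + 0) (i + 0) * φ (2 * i + 0)) ∎
  where open ≡-Reasoning
Ξ-closed 1 k φ _ = begin
  Ξ φ (2 * k + 1)    ≡⟨ cong (Ξ φ) (+-comm (2 * k) 1) ⟩
  Ξ φ (suc (2 * k))  ≡⟨ Ξ-odd k φ ⟩
  2 ^ suc k * Σ[0to k ] (λ i → oddCoeff k i * φ (suc (2 * i)))
    ≡⟨ cong₂ (λ m s → 2 ^ m * s) (+-comm 1 k) (∑-cong (upTo (suc k)) λ i →
         cong₂ _*_ (cong (2 ^ i * (k C i) *_) (cong₂ poch12Quot (+-comm 1 k) (+-comm 1 i)))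
                   (cong φ (+-comm 1 (2 * i)))) ⟩
  2 ^ (k + 1) * Σ[0to k ] (λ i → 2 ^ i * (k C i) * poch12Quot (k + 1) (i + 1) * φ (2 * i + 1)) ∎
  where open ≡-Reasoning
Ξ-closed (suc (suc _)) k φ (s≤s (s≤s ()))

-- Translation to the indices of the theorem

halve : ∀ i r → (4 * i + r) / 2 ≡ 2 * i + r / 2
halve i r = begin
  (4 * i + r) / 2          ≡⟨ /-congˡ {o = 2} (cong (_+ r) (double i)) ⟩
  (2 * i * 2 + r) / 2      ≡⟨ +-distrib-/-∣ˡ r {2} (n∣m*n (2 * i)) ⟩
  2 * i * 2 / 2 + r / 2    ≡⟨ cong (_+ r / 2) (m*n/n≡m (2 * i) 2) ⟩
  2 * i + r / 2            ∎
  where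
  open ≡-Reasoning
  double : ∀ i → 4 * i ≡ 2 * i * 2
  double = solve-∀

parity : ∀ i r → (4 * i + r) % 2 ≡ r % 2
parity i r = trans (%-congˡ {o = 2} (rearrange i r)) ([m+kn]%n≡m%n r (2 * i) 2)
  where
  rearrange : ∀ i r → 4 * i + r ≡ r + 2 * i * 2
  rearrange = solve-∀

theorem3p2 : (k r : ℕ) → r < 4 →
    t (4 * k + r)
    ≡ 2 ^ (k + r / 2)
    * Σ[0to k ] (λ i → 2 ^ i * (k C i)
    * poch12Quot (k + r / 2) (i + r / 2)
    * g (4 * i + r))
theorem3p2 k r r<4 = begin
  t (4 * k + r)
    ≡⟨ t≡graphCount (4 * k + r) ⟩
  graphCount (4 * k + r) 0
    -- The split is a = r % 2 and b = 2k + r / 2. Then removing k-i double edges leaves b = 2i + r /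
    -- 2, and these two numbers are the remainder and quotient of 4i + r by 2, so that
    -- `g (4 * i + r)` appears.
    ≡⟨ cong (λ n → graphCount n 0) (trans (cong (4 * k +_) (m≡m%n+[m/n]*n r 2)) (rearrange k (r % 2) (r / 2))) ⟩
  graphCount (r % 2 + 2 * (2 * k + r / 2)) 0
    ≡⟨ T≡τ graphCount graphCount-rec₁ graphCount-rec₂ (2 * k + r / 2) (r % 2) ⟨
  Ξ (graphCount (r % 2)) (2 * k + r / 2)
    ≡⟨ Ξ-closed (r / 2) k (graphCount (r % 2)) (m<n*o⇒m/o<n {r} {2} {2} r<4) ⟩
  2 ^ (k + r / 2) * Σ[0to k ] (λ i → 2 ^ i * (k C i) * poch12Quot (k + r / 2) (i + r / 2) * graphCount (r % 2) (2 * i + r / 2))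
    ≡⟨ cong (2 ^ (k + r / 2) *_) (∑-cong (upTo (suc k)) λ i →
         cong (2 ^ i * (k C i) * poch12Quot (k + r / 2) (i + r / 2) *_)
              (sym (trans (g≡graphCount (4 * i + r)) (cong₂ graphCount (parity i r) (halve i r))))) ⟩
  2 ^ (k + r / 2) * Σ[0to k ] (λ i → 2 ^ i * (k C i) * poch12Quot (k + r / 2) (i + r / 2) * g (4 * i + r)) ∎
  where
  open ≡-Reasoning
  rearrange : ∀ k a h → 4 * k + (a + h * 2) ≡ a + 2 * (2 * k + h)
  rearrange = solve-∀
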